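{- Let $n\in\mathbf{N}$. For each $k$ with $0\le k<n$, the inner loop at $k$ of the combing algorithm defines a bijection, and the inner loop at $k$ of the uncombing algorithm defines the inverse bijection, between $\mathrm{Pathfam}(n,k+1)$ and $\mathrm{Pathfam}(n,k)$.
   Context: **Paths.** A Schröder-type path is a sequence $(p_0,\ldots,p_m)$ of points of $\mathbf{Z}\times\mathbf{Z}$, $m\in\mathbf{N}$, with each $p_{l+1}-p_l\in\{(0,+1),(-1,+1),(-1,0)\}$ (a horizontal, diagonal, vertical step respectively); its support is $\{p_0,\ldots,p_m\}$. Column $j$ is the set of points with second coordinate $j$. An $n$-family is an $n$-tuple $(P_0,\ldots,P_{n-1})$ with $P_i$ a Schröder-type path from $(i,0)$ to $(0,i)$. **Encoding.** $\mathrm{Pathfam}(n)$ is the set of pairs $(B,D)$ of matrices indexed by $[n]\times[n]$, $[n]=\{0,\ldots,n-1\}$, with $B$ strictly lower triangular with entries in $\{0,1\}$ and $D$ weakly lower triangular with entries in $\mathbf{N}$. An $n$-family is encoded by the pair $(B,D)\in\mathrm{Pathfam}(n)$ for which, for $j<i$, $B_{i,j}=0$ (resp. $1$) if the step of $P_i$ from column $j$ to column $j+1$ is horizontal (resp. diagonal), and, for $j\le i$, $D_{i,j}$ is the number of vertical steps of $P_i$ in column $j$. (So $(B,D)$ encodes an $n$-family if and only if $\sum_{j<i}B_{i,j}+\sum_{j\le i}D_{i,j}=i$ for all $i\in[n]$.) For $0\le k\le n$, $\mathrm{Pathfam}(n,k)$ is the subset of $\mathrm{Pathfam}(n)$ of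 pairs $(B,D)$ encoding $n$-families without any vertical steps in any non-final column before column $k$ (that is, $D_{i,j}=0$ whenever $0\le j<k$ and $j<i<n$) and for which the supports of the paths $P_k,\ldots,P_{n-1}$ are all pairwise disjoint. **Basic operations** (for $0\le k\le i<n-1$; "$\gets$" is assignment). untangle$(i,k)$: set $cur\gets0$, $d\gets0$. For $j$ from $0$ up to $k-1$: set $cur\gets cur+B[i+1,j]-B[i,j]$; if $cur>d$ then set $d\gets cur$, $B[i,j]\gets1$, $B[i+1,j]\gets0$. After the loop set $D[i,k]\gets D[i,k]-d$ and $D[i+1,k]\gets d$. cliffify$(i,k)$ (also uses an auxiliary integer array $h$): set $d\gets D[i+1,k]$ and $cur\gets h[i+1]-h[i]-1$; set $D[i+1,k]\gets0$, $D[i,k]\gets D[i,k]+d$; set $h[i+1]\gets h[i+1]-d$, $h[i]\gets h[i]+d$. Then for $j$ from $k-1$ down to $0$: set $cur\gets cur+B[i+1,j]-B[i,j]$; if $cur<d$ then set $d\gets cur$, $B[i,j]\gets0$, $B[i+1,j]\gets1$. **Inner loops.** The inner loop at $k$ of the combing algorithm is: for $i$ from $k$ up to $n-2$ execute untangle$(i,k)$. (In the full algorithm it is preceded by $D[k,k]\gets k-\sum_{0\le j<k}B[k,j]$, which changes nothing for elements of $\mathrm{Pathfam}(n,k+1)$.) The inner loop at $k$ of the uncombing algorithm is: for $i$ from $n-1$ down to $k$: if $k=0$ set $h[i]\gets i$, otherwise set $h[i]\gets h[i]-B[i,k-1]$; then, if $i<n-1$, execute cliffify$(i,k)$. When $k>0$,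 it is assumed that $h[i]=i-\sum_{j=0}^{k-2}B_{i,j}$ for all $k\le i<n$ at the start of this loop (as results from the earlier loops at $0,\ldots,k-1$). -}

module Defs where

open import Data.Bool.Base using (if_then_else_)
open import Data.Fin.Base using (Fin; zero; suc; toℕ; fromℕ; inject; inject₁)
open import Data.Fin.Relation.Unary.Top using (view; ‵fromℕ; ‵inject₁)
open import Data.Integer.Base using (ℤ; +_; 0ℤ; 1ℤ; -1ℤ; _+_; _-_; _≤_)
import Data.Integer.Properties as ℤ
open import Data.List.Base using (List; []; _∷_; length; filter)
open import Data.List.Membership.Propositional using (_∈_)
open import Data.List.Relation.Binary.Disjoint.Propositional using (Disjoint)
import Data.Nat.Base as ℕ
open import Data.Nat.Base using (ℕ; zero; suc)
import Data.Nat.Properties as ℕ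
open import Data.Product.Base using (Σ; _×_; _,_; proj₁; proj₂; ∃-syntax)
open import Data.Product.Properties using (≡-dec)
open import Data.Sum.Base using (_⊎_)
open import Data.Vec.Base using (Vec; []; _∷_; lookup; _[_]≔_; _[_]%=_)
open import Function.Base using (id; _∘_)
open import Level using (0ℓ)
open import Relation.Binary.Bundles using (Setoid)
import Relation.Binary.Construct.On as On
open import Relation.Binary.Construct.Closure.ReflexiveTransitive using (Star; ε; _◅_)
open import Relation.Binary.Definitions using (DecidableEquality)
open import Relation.Binary.PropositionalEquality
  using (_≡_; _≢_; refl; setoid)
open import Relation.Nullary.Decidable.Core using (does; yes; no)

------------------------------------------------------------------------
-- Paths

-- Coordinates as for matrix entries: first the row, then the column.
Point : Set
Point = ℤ × ℤ

data Direction : Set where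
  horizontal diagonal vertical : Direction

_≟ᴰ_ : DecidableEquality Direction
horizontal ≟ᴰ horizontal = yes refl
horizontal ≟ᴰ diagonal   = no λ ()
horizontal ≟ᴰ vertical   = no λ ()
diagonal   ≟ᴰ horizontal = no λ ()
diagonal   ≟ᴰ diagonal   = yes refl
diagonal   ≟ᴰ vertical   = no λ ()
vertical   ≟ᴰ horizontal = no λ ()
vertical   ≟ᴰ diagonal   = no λ ()
vertical   ≟ᴰ vertical   = yes refl

move : Direction → Point → Point
move horizontal (r , c) = r        , c + 1ℤ
move diagonal   (r , c) = r + -1ℤ  , c + 1ℤ
move vertical   (r , c) = r + -1ℤ  , c

Step : Point → Point → Set
Step p q = ∃[ δ ] q ≡ move δ p

Path : Point → Point → Set
Path = Star Step

support : ∀ {p q} → Path p q → List Point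
support {p} ε       = p ∷ []
support {p} (_ ◅ π) = p ∷ support π

-- The direction of each step, with the column in which it starts.
steps : ∀ {p q} → Path p q → List (Direction × ℤ)
steps ε                 = []
steps {p} ((δ , _) ◅ π) = (δ , proj₂ p) ∷ steps π

verticalSteps : ∀ {p q} → ℤ → Path p q → ℕ
verticalSteps c π = length (filter (≡-dec _≟ᴰ_ ℤ._≟_ (vertical , c)) (steps π))

Family : ℕ → Set
Family n = (i : Fin n) → Path (+ toℕ i , 0ℤ) (0ℤ , + toℕ i)

------------------------------------------------------------------------
-- Pairs of matrices

-- The algorithms work on integer arrays, so that subtraction is not
-- truncated; the ranges {0,1} and ℕ of the entries are imposed by IsPathfam.
Matrix : ℕ → Set
Matrix n = Vec (Vec ℤ n) n

infixl 9 _!_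

_!_ : ∀ {A : Set} {n} → Vec A n → Fin n → A
_!_ = lookup

set : ∀ {n} → Fin n → Fin n → ℤ → Matrix n → Matrix n
set i j x M = M [ i ]%= (_[ j ]≔ x)

Pair : ℕ → Set
Pair n = Matrix n × Matrix n

record IsPathfam {n : ℕ} (BD : Pair n) : Set where
  private
    B = proj₁ BD
    D = proj₂ BD
  field
    B-entries    : ∀ i j → B ! i ! j ≡ 0ℤ ⊎ B ! i ! j ≡ 1ℤ
    B-triangular : ∀ i j → toℕ i ℕ.≤ toℕ j → B ! i ! j ≡ 0ℤ
    D-entries    : ∀ i j → 0ℤ ≤ D ! i ! j
    D-triangular : ∀ i j → toℕ i ℕ.< toℕ j → D ! i ! j ≡ 0ℤ

record Encodes {n : ℕ} (BD : Pair n) (P : Family n) : Set where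
  private
    B = proj₁ BD
    D = proj₂ BD
  field
    horizontal⇒0 : ∀ i j → toℕ j ℕ.< toℕ i →
                   (horizontal , + toℕ j) ∈ steps (P i) → B ! i ! j ≡ 0ℤ
    diagonal⇒1   : ∀ i j → toℕ j ℕ.< toℕ i →
                   (diagonal , + toℕ j) ∈ steps (P i) → B ! i ! j ≡ 1ℤ
    verticals    : ∀ i j → toℕ j ℕ.≤ toℕ i →
                   D ! i ! j ≡ + verticalSteps (+ toℕ j) (P i)

record IsPathfamAt {n : ℕ} (k : ℕ) (BD : Pair n) : Set where
  field
    isPathfam       : IsPathfam BD
    family          : Family n
    encodes         : Encodes BD family
    noEarlyVertical : ∀ i j → toℕ j ℕ.< k → toℕ j ℕ.< toℕ i →
                      proj₂ BD ! i ! j ≡ 0ℤ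
    disjoint        : ∀ i i′ → k ℕ.≤ toℕ i → k ℕ.≤ toℕ i′ → i ≢ i′ →
                      Disjoint (support (family i)) (support (family i′))

-- Elements are compared through their pairs of matrices only.
Pathfam : ℕ → ℕ → Setoid 0ℓ 0ℓ
Pathfam n k = On.setoid {B = Σ (Pair n) (IsPathfamAt k)} (setoid (Pair n)) proj₁

------------------------------------------------------------------------
-- Loops over 0, …, n-1 in increasing and in decreasing order

forUp : ∀ {S : Set} n → (Fin n → S → S) → S → S
forUp zero    body s = s
forUp (suc n) body s = body (fromℕ n) (forUp n (body ∘ inject₁) s)

forDown : ∀ {S : Set} n → (Fin n → S → S) → S → S
forDown zero    body s = s
forDown (suc n) body s = forDown n (body ∘ inject₁) (body (fromℕ n) s)

------------------------------------------------------------------------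
-- Combing.  For i : Fin m, the rows i and i+1 of a matrix of size suc m are
-- those with index inject₁ i and suc i.

untangleStep : ∀ {m} → Fin m → Fin (suc m) →
               Matrix (suc m) × ℤ × ℤ → Matrix (suc m) × ℤ × ℤ
untangleStep i j (B , cur , d) =
  let cur′ = cur + B ! suc i ! j - B ! inject₁ i ! j
  in if does (d ℤ.<? cur′)
     then (set (suc i) j 0ℤ (set (inject₁ i) j 1ℤ B) , cur′ , cur′)
     else (B , cur′ , d)

untangle : ∀ {m} → Fin m → Fin (suc m) → Pair (suc m) → Pair (suc m)
untangle i k (B , D) =
  let (B′ , _ , d) = forUp (toℕ k) (untangleStep i ∘ inject) (B , 0ℤ , 0ℤ)
      D′           = set (inject₁ i) k (D ! inject₁ i ! k - d) D
  in B′ , set (suc i) k d D′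

combLoop : ∀ {n} → Fin n → Pair n → Pair n
combLoop {suc m} k = forUp m λ i →
  if does (toℕ k ℕ.≤? toℕ i) then untangle i k else id

------------------------------------------------------------------------
-- Uncombing.  The state includes the auxiliary array h.

State : ℕ → Set
State n = Pair n × Vec ℤ n

cliffifyStep : ∀ {m} → Fin m → Fin (suc m) →
               Matrix (suc m) × ℤ × ℤ → Matrix (suc m) × ℤ × ℤ
cliffifyStep i j (B , cur , d) =
  let cur′ = cur + B ! suc i ! j - B ! inject₁ i ! j
  in if does (cur′ ℤ.<? d)
     then (set (suc i) j 1ℤ (set (inject₁ i) j 0ℤ B) , cur′ , cur′)
     else (B , cur′ , d)

cliffify : ∀ {m} → Fin m → Fin (suc m) → State (suc m) → State (suc m)
cliffify i k ((B , D) , h) =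
  let d   = D ! suc i ! k
      cur = h ! suc i - h ! inject₁ i - 1ℤ
      D₁  = set (suc i) k 0ℤ D
      D₂  = set (inject₁ i) k (D₁ ! inject₁ i ! k + d) D₁
      h₁  = h  [ suc i ]≔ (h ! suc i - d)
      h₂  = h₁ [ inject₁ i ]≔ (h₁ ! inject₁ i + d)
      (B′ , _) = forDown (toℕ k) (cliffifyStep i ∘ inject) (B , cur , d)
  in (B′ , D₂) , h₂

setHeight : ∀ {m} → Fin (suc m) → Fin (suc m) → State (suc m) → State (suc m)
setHeight zero    i (BD , h)      = BD , h [ i ]≔ + toℕ i
setHeight (suc k) i ((B , D) , h) =
  (B , D) , h [ i ]≔ (h ! i - B ! i ! inject₁ k)

cliffifyUnlessLast : ∀ {m} → Fin (suc m) → Fin (suc m) →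
                     State (suc m) → State (suc m)
cliffifyUnlessLast i k with view i
... | ‵fromℕ     = id
... | ‵inject₁ j = cliffify j k

uncombLoop : ∀ {n} → Fin n → State n → State n
uncombLoop {suc m} k = forDown (suc m) λ i →
  if does (toℕ k ℕ.≤? toℕ i) then cliffifyUnlessLast i k ∘ setHeight k i else id

sumFirst : ∀ {n} → ℕ → Vec ℤ n → ℤ
sumFirst zero    _        = 0ℤ
sumFirst (suc l) []       = 0ℤ
sumFirst (suc l) (x ∷ xs) = x + sumFirst l xs

-- The assumption on h at the start of the loop at k; the sum is over the
-- columns 0, …, k-2.
Prepared : ∀ {n} → Fin n → State n → Set
Prepared {n} k ((B , _) , h) =
  0 ℕ.< toℕ k → (i : Fin n) → toℕ k ℕ.≤ toℕ i →
  h ! i ≡ + toℕ i - sumFirst (ℕ.pred (toℕ k)) (B ! i)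

-- In the columns 0, …, k, let q i be the heights of the paths of an element of
-- Pathfam(n,k+1) and p i those of its image.  Untangling rows i and i+1 is a Pitman
-- transformation: it turns an intermediate path X i (where X k = q k) and q (i+1)
-- into p i = X i - μ and X (i+1) = q (i+1) + μ, where μ is the running maximum of
-- X i - q (i+1) + 1.  Cliffifying turns p i and X (i+1) into X i = p i + ν and
-- q (i+1) = X (i+1) - ν, where ν is the running minimum, from column k backwards, of
-- X (i+1) - p i - 1.  Each of μ and ν is determined by a recursion that the other one
-- satisfies, so the two operations are inverse to each other.
--
-- Disjointness amounts to the interlacing q i ≤ p i < q (i+1), where for i = k the
-- path q k is replaced by the lowest possible one.  In combing, X i - q i
-- is weakly increasing and at least X i - q (i+1) + 1, hence at least μ, so p i ≥ q i.
-- In uncombing, X (i+1) - p (i+1) is weakly increasing and at most X (i+1) - p i - 1,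
-- hence at most ν, so q (i+1) ≤ p (i+1); this also makes ν vanish in column 0.
-- Nothing happens to the right of column k since the heights at which the paths leave
-- that column do not change.

module Submission where

open import Defs
open import Data.Nat.Base using (ℕ; suc)
open import Data.Integer.Base using (ℤ)
open import Data.Fin.Base using (Fin; toℕ)
open import Data.Vec.Base using (Vec)
open import Data.Product.Base using (Σ-syntax; _×_; _,_; proj₁)
open import Function.Bundles using (Inverse)
open import Relation.Binary.Bundles using (Setoid)
open import Relation.Binary.PropositionalEquality using (_≡_)

open import Data.Bool.Base using (if_then_else_)
open import Data.Empty using (⊥; ⊥-elim)
open import Data.Fin.Base using (zero; suc; fromℕ; fromℕ<; inject; inject₁)
import Data.Fin.Properties as Fin
open import Data.Fin.Relation.Unary.Top using (view-fromℕ; view-inject₁)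
open import Data.Integer.Base
  using (+_; 0ℤ; 1ℤ; -1ℤ; -_; _+_; _-_; _≤_; _⊔_; _⊓_; ∣_∣; +≤+; +<+)
import Data.Integer.Base as ℤ
import Data.Integer.Properties as ℤ
open import Data.Integer.Tactic.RingSolver using (solve-∀)
open import Data.List.Base using (length)
open import Data.List.Membership.Propositional using (_∈_)
import Data.List.Properties as List
open import Data.List.Relation.Unary.Any using (here; there)
open import Data.Nat.Base using (zero; _<_; _∸_; z≤n; s≤s)
import Data.Nat.Base as ℕ
import Data.Nat.Properties as ℕ
open import Data.Product.Base using (proj₂)
open import Data.Product.Properties using (≡-dec)
open import Data.Sum.Base using (_⊎_; inj₁; inj₂; [_,_]′)
open import Data.Vec.Base using ([]; _∷_; _[_]≔_; _[_]%=_; tabulate)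
open import Data.Vec.Properties using (lookup∘tabulate)
open import Function.Base using (id; _∘_)
open import Relation.Binary.Construct.Closure.ReflexiveTransitive using (ε; _◅_)
open import Relation.Binary.Definitions using (tri<; tri≈; tri>)
open import Relation.Binary.PropositionalEquality
  using (_≢_; refl; sym; trans; cong; cong₂; subst; subst₂)
open import Relation.Nullary using (¬_; yes; no; does)
open import Relation.Nullary.Decidable using (dec-true; dec-false)

private variable
  n p : ℕ

≤-from : ∀ {a b c d} → c ≤ d → b - a ≡ d - c → a ≤ b
≤-from c≤d eq = ℤ.0≤i-j⇒j≤i (subst (0ℤ ≤_) (sym eq) (ℤ.i≤j⇒0≤j-i c≤d))

Bit : ℤ → Set
Bit x = x ≡ 0ℤ ⊎ x ≡ 1ℤ

0≤bit : ∀ {x} → Bit x → 0ℤ ≤ x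
0≤bit (inj₁ refl) = ℤ.≤-refl
0≤bit (inj₂ refl) = +≤+ z≤n

bit≤1 : ∀ {x} → Bit x → x ≤ 1ℤ
bit≤1 (inj₁ refl) = +≤+ z≤n
bit≤1 (inj₂ refl) = ℤ.≤-refl

jump-up : ∀ {x y c M} → Bit x → Bit y → c ≤ M → M ℤ.< c + y - x →
          x ≡ 0ℤ × y ≡ 1ℤ × c ≡ M
jump-up {c = c} {M} (inj₁ refl) (inj₁ refl) c≤M lt = ⊥-elim (ℤ.<⇒≱ lt
  (≤-from c≤M (eq c M)))
  where eq : ∀ c M → M - (c + 0ℤ - 0ℤ) ≡ M - c
        eq = solve-∀
jump-up {c = c} {M} (inj₁ refl) (inj₂ refl) c≤M lt =
  refl , refl , ℤ.≤-antisym c≤M (≤-from (ℤ.i<j⇒suc[i]≤j lt) (eq c M))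
  where eq : ∀ c M → c - M ≡ (c + 1ℤ - 0ℤ) - (1ℤ + M)
        eq = solve-∀
jump-up {c = c} {M} (inj₂ refl) (inj₁ refl) c≤M lt = ⊥-elim (ℤ.<⇒≱ lt
  (≤-from (ℤ.+-mono-≤ c≤M (+≤+ (z≤n {1}))) (eq c M)))
  where eq : ∀ c M → M - (c + 0ℤ - 1ℤ) ≡ (M + 1ℤ) - (c + 0ℤ)
        eq = solve-∀
jump-up {c = c} {M} (inj₂ refl) (inj₂ refl) c≤M lt = ⊥-elim (ℤ.<⇒≱ lt
  (≤-from c≤M (eq c M)))
  where eq : ∀ c M → M - (c + 1ℤ - 1ℤ) ≡ M - c
        eq = solve-∀

jump-down : ∀ {x y g M} → Bit x → Bit y → M ≤ g → g + y - x ℤ.< M →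
            x ≡ 1ℤ × y ≡ 0ℤ × g ≡ M
jump-down {x} {y} {g} {M} bx by M≤g lt
  with jump-up by bx (ℤ.neg-mono-≤ M≤g)
         (subst (- M ℤ.<_) (eq x y g) (ℤ.neg-mono-< lt))
  where eq : ∀ x y g → - (g + y - x) ≡ - g + x - y
        eq = solve-∀
... | y≡0 , x≡1 , -g≡-M = x≡1 , y≡0 , ℤ.neg-injective -g≡-M

-- Matrices with indices in ℕ

-- Outside of the range, the entries are 0.
at : Vec ℤ n → ℕ → ℤ
at []       _       = 0ℤ
at (x ∷ _)  zero    = x
at (_ ∷ xs) (suc j) = at xs j

ent : Vec (Vec ℤ p) n → ℕ → ℕ → ℤ
ent []      _       _ = 0ℤ
ent (v ∷ _) zero    b = at v b
ent (_ ∷ M) (suc a) b = ent M a b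

at-! : (v : Vec ℤ n) (j : Fin n) → at v (toℕ j) ≡ v ! j
at-! (x ∷ _)  zero    = refl
at-! (_ ∷ xs) (suc j) = at-! xs j

ent-row : (M : Vec (Vec ℤ p) n) (i : Fin n) (b : ℕ) → ent M (toℕ i) b ≡ at (M ! i) b
ent-row (_ ∷ _) zero    b = refl
ent-row (_ ∷ M) (suc i) b = ent-row M i b

ent-! : (M : Vec (Vec ℤ p) n) (i : Fin n) (j : Fin p) →
        ent M (toℕ i) (toℕ j) ≡ M ! i ! j
ent-! M i j = trans (ent-row M i (toℕ j)) (at-! (M ! i) j)

at-all : (P : ℕ → ℤ → Set) (v : Vec ℤ n) → (∀ j → P j 0ℤ) →
         (∀ j → P (toℕ j) (v ! j)) → ∀ b → P b (at v b)
at-all P []       z all b       = z b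
at-all P (x ∷ v)  z all zero    = all zero
at-all P (x ∷ v)  z all (suc b) = at-all (P ∘ suc) v (z ∘ suc) (all ∘ suc) b

ent-all : (P : ℕ → ℕ → ℤ → Set) (M : Vec (Vec ℤ p) n) → (∀ a b → P a b 0ℤ) →
          (∀ i j → P (toℕ i) (toℕ j) (M ! i ! j)) → ∀ a b → P a b (ent M a b)
ent-all P []      z all a       b = z a b
ent-all P (v ∷ M) z all zero    b = at-all (P 0) v (z 0) (all zero) b
ent-all P (v ∷ M) z all (suc a) b = ent-all (P ∘ suc) M (z ∘ suc) (all ∘ suc) a b

at-ext : (v w : Vec ℤ n) → (∀ b → at v b ≡ at w b) → v ≡ w
at-ext []      []      eq = refl
at-ext (x ∷ v) (y ∷ w) eq = cong₂ _∷_ (eq 0) (at-ext v w (eq ∘ suc))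

ent-ext : (M N : Vec (Vec ℤ p) n) → (∀ a b → ent M a b ≡ ent N a b) → M ≡ N
ent-ext []      []      eq = refl
ent-ext (v ∷ M) (w ∷ N) eq = cong₂ _∷_ (at-ext v w (eq 0)) (ent-ext M N (eq ∘ suc))

at-≔ : (v : Vec ℤ n) (j : Fin n) (x : ℤ) → at (v [ j ]≔ x) (toℕ j) ≡ x
at-≔ (_ ∷ _) zero    x = refl
at-≔ (_ ∷ v) (suc j) x = at-≔ v j x

at-≔-other : (v : Vec ℤ n) (j : Fin n) (x : ℤ) {b : ℕ} → b ≢ toℕ j →
             at (v [ j ]≔ x) b ≡ at v b
at-≔-other (_ ∷ _) zero    x {zero}  b≢j = ⊥-elim (b≢j refl)
at-≔-other (_ ∷ _) zero    x {suc b} b≢j = refl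
at-≔-other (_ ∷ _) (suc j) x {zero}  b≢j = refl
at-≔-other (_ ∷ v) (suc j) x {suc b} b≢j = at-≔-other v j x (b≢j ∘ cong suc)

ent-%= : (M : Vec (Vec ℤ p) n) (i : Fin n) (f : Vec ℤ p → Vec ℤ p) (b : ℕ) →
         ent (M [ i ]%= f) (toℕ i) b ≡ at (f (M ! i)) b
ent-%= (_ ∷ _) zero    f b = refl
ent-%= (_ ∷ M) (suc i) f b = ent-%= M i f b

ent-%=-other : (M : Vec (Vec ℤ p) n) (i : Fin n) (f : Vec ℤ p → Vec ℤ p) {a : ℕ} (b : ℕ) →
               a ≢ toℕ i → ent (M [ i ]%= f) a b ≡ ent M a b
ent-%=-other (_ ∷ _) zero    f {zero}  b a≢i = ⊥-elim (a≢i refl)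
ent-%=-other (_ ∷ _) zero    f {suc a} b a≢i = refl
ent-%=-other (_ ∷ _) (suc i) f {zero}  b a≢i = refl
ent-%=-other (_ ∷ M) (suc i) f {suc a} b a≢i = ent-%=-other M i f b (a≢i ∘ cong suc)

ent-set : (M : Matrix n) (i j : Fin n) (x : ℤ) {a b : ℕ} → a ≡ toℕ i → b ≡ toℕ j →
          ent (set i j x M) a b ≡ x
ent-set M i j x refl refl = trans (ent-%= M i _ (toℕ j)) (at-≔ (M ! i) j x)

ent-set-other : (M : Matrix n) (i j : Fin n) (x : ℤ) {a b : ℕ} →
                a ≢ toℕ i ⊎ b ≢ toℕ j → ent (set i j x M) a b ≡ ent M a b
ent-set-other M i j x {a} {b} ne with a ℕ.≟ toℕ i
ent-set-other M i j x ne            | no a≢i = ent-%=-other M i _ _ a≢i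
ent-set-other M i j x (inj₁ a≢i)    | yes a≡i = ⊥-elim (a≢i a≡i)
ent-set-other M i j x {_} {b} (inj₂ b≢j) | yes refl =
  trans (ent-%= M i _ b) (trans (at-≔-other (M ! i) j x b≢j) (sym (ent-row M i b)))

private
  reindex : ∀ {S : Set} (P : ℕ → S → Set) {a b s} → a ≡ b → P a s → P b s
  reindex P refl q = q

forUp-ind : ∀ {S : Set} n (P : ℕ → S → Set) {body : Fin n → S → S} {s} → P 0 s →
            (∀ j s → P (toℕ j) s → P (suc (toℕ j)) (body j s)) → P n (forUp n body s)
forUp-ind zero    P base step = base
forUp-ind (suc n) P base step =
  reindex (P ∘ suc) (Fin.toℕ-fromℕ n)
    (step (fromℕ n) _ (reindex P (sym (Fin.toℕ-fromℕ n))
      (forUp-ind n P base λ j s q → reindex (P ∘ suc) (Fin.toℕ-inject₁ j)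
         (step (inject₁ j) s (reindex P (sym (Fin.toℕ-inject₁ j)) q)))))

forDown-ind : ∀ {S : Set} n (P : ℕ → S → Set) {body : Fin n → S → S} {s} → P n s →
              (∀ j s → P (suc (toℕ j)) s → P (toℕ j) (body j s)) → P 0 (forDown n body s)
forDown-ind zero    P base step = base
forDown-ind (suc n) P base step =
  forDown-ind n P
    (reindex P (Fin.toℕ-fromℕ n)
      (step (fromℕ n) _ (reindex (P ∘ suc) (sym (Fin.toℕ-fromℕ n)) base)))
    λ j s q → reindex P (Fin.toℕ-inject₁ j)
      (step (inject₁ j) s (reindex (P ∘ suc) (sym (Fin.toℕ-inject₁ j)) q))

-- The row in which the path from (a, 0) reaches column j if it has no vertical
-- steps before.
ht : Vec (Vec ℤ p) n → ℕ → ℕ → ℤ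
ht B a zero    = + a
ht B a (suc j) = ht B a j - ent B a j

ht-cong : (B B′ : Vec (Vec ℤ p) n) (a j : ℕ) → (∀ l → l < j → ent B a l ≡ ent B′ a l) →
          ht B a j ≡ ht B′ a j
ht-cong B B′ a zero    eq = refl
ht-cong B B′ a (suc j) eq =
  cong₂ _-_ (ht-cong B B′ a j λ l l<j → eq l (ℕ.m<n⇒m<1+n l<j)) (eq j ℕ.≤-refl)

record Shifted (i : ℕ) (R : ℕ → Set) (δ : ℕ → ℤ) (B B′ : Matrix n) : Set where
  field
    upper : ∀ l → R l → ent B′ i l ≡ ent B i l + δ l
    lower : ∀ l → R l → ent B′ (suc i) l ≡ ent B (suc i) l - δ l
    other : ∀ a l → (a ≢ i × a ≢ suc i) ⊎ ¬ R l → ent B′ a l ≡ ent B a l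

shifted-⊎ : ∀ {i j δ} {R R′ : ℕ → Set} {B B′ B″ : Matrix n} →
            Shifted i R δ B B′ → Shifted i (_≡ j) δ B′ B″ → ¬ R j → R′ j →
            (∀ l → l ≢ j → (R l → R′ l) × (R′ l → R l)) → Shifted i R′ δ B B″
shifted-⊎ {i = i} {j} {δ} {R} {R′} {B} {B′} {B″} s t ¬Rj R′j conv = record
  { upper = up ; lower = lo ; other = ot }
  where
  module S = Shifted s
  module T = Shifted t
  up : ∀ l → R′ l → ent B″ i l ≡ ent B i l + δ l
  up l r with l ℕ.≟ j
  ... | yes refl = trans (T.upper l refl) (cong (_+ δ l) (S.other i l (inj₂ ¬Rj)))
  ... | no l≢j = trans (T.other i l (inj₂ l≢j)) (S.upper l (proj₂ (conv l l≢j) r))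
  lo : ∀ l → R′ l → ent B″ (suc i) l ≡ ent B (suc i) l - δ l
  lo l r with l ℕ.≟ j
  ... | yes refl = trans (T.lower l refl) (cong (_- δ l) (S.other (suc i) l (inj₂ ¬Rj)))
  ... | no l≢j = trans (T.other (suc i) l (inj₂ l≢j)) (S.lower l (proj₂ (conv l l≢j) r))
  ot : ∀ a l → (a ≢ i × a ≢ suc i) ⊎ ¬ R′ l → ent B″ a l ≡ ent B a l
  ot a l (inj₁ x) = trans (T.other a l (inj₁ x)) (S.other a l (inj₁ x))
  ot a l (inj₂ ¬r) with l ℕ.≟ j
  ... | yes refl = ⊥-elim (¬r R′j)
  ... | no l≢j = trans (T.other a l (inj₂ l≢j)) (S.other a l (inj₂ (¬r ∘ proj₁ (conv l l≢j))))

Bits : Vec (Vec ℤ p) n → Set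
Bits B = ∀ a b → Bit (ent B a b)

bits-set : (B : Matrix n) (i j : Fin n) {x : ℤ} → Bit x → Bits B → Bits (set i j x B)
bits-set B i j {x} bx bits a b with a ℕ.≟ toℕ i | b ℕ.≟ toℕ j
... | yes p | yes q = subst Bit (sym (ent-set B i j x p q)) bx
... | no p  | _     = subst Bit (sym (ent-set-other B i j x (inj₁ p))) (bits a b)
... | _     | no q  = subst Bit (sym (ent-set-other B i j x (inj₂ q))) (bits a b)

module TwoRows {m : ℕ} (i : Fin m) where

  ι : ℕ
  ι = toℕ i

  ι≡ : ι ≡ toℕ (inject₁ i)
  ι≡ = sym (Fin.toℕ-inject₁ i)

  at-upper : (M : Matrix (suc m)) (j : Fin (suc m)) → M ! inject₁ i ! j ≡ ent M ι (toℕ j)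
  at-upper M j = trans (sym (ent-! M (inject₁ i) j))
                       (cong (λ a → ent M a (toℕ j)) (Fin.toℕ-inject₁ i))

  at-lower : (M : Matrix (suc m)) (j : Fin (suc m)) → M ! suc i ! j ≡ ent M (suc ι) (toℕ j)
  at-lower M j = sym (ent-! M (suc i) j)

  put : Fin (suc m) → ℤ → ℤ → Matrix (suc m) → Matrix (suc m)
  put j x y M = set (suc i) j y (set (inject₁ i) j x M)

  put-upper : ∀ M j x y {b} → b ≡ toℕ j → ent (put j x y M) ι b ≡ x
  put-upper M j x y e =
    trans (ent-set-other (set (inject₁ i) j x M) (suc i) j y (inj₁ (ℕ.<⇒≢ (ℕ.n<1+n ι))))
          (ent-set M (inject₁ i) j x ι≡ e)

  put-lower : ∀ M j x y {b} → b ≡ toℕ j → ent (put j x y M) (suc ι) b ≡ y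
  put-lower M j x y e = ent-set (set (inject₁ i) j x M) (suc i) j y refl e

  put-other : ∀ M j x y {a b} → (a ≢ ι × a ≢ suc ι) ⊎ b ≢ toℕ j →
              ent (put j x y M) a b ≡ ent M a b
  put-other M j x y (inj₁ (p , q)) =
    trans (ent-set-other (set (inject₁ i) j x M) (suc i) j y (inj₁ q))
          (ent-set-other M (inject₁ i) j x (inj₁ λ e → p (trans e (sym ι≡))))
  put-other M j x y (inj₂ p) =
    trans (ent-set-other (set (inject₁ i) j x M) (suc i) j y (inj₂ p))
          (ent-set-other M (inject₁ i) j x (inj₂ p))

  put-shifted : ∀ M j x y {δ} → x ≡ ent M ι (toℕ j) + δ (toℕ j) →
                y ≡ ent M (suc ι) (toℕ j) - δ (toℕ j) →
                Shifted ι (_≡ toℕ j) δ M (put j x y M)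
  put-shifted M j x y ex ey = record
    { upper = λ { _ refl → trans (put-upper M j x y refl) ex }
    ; lower = λ { _ refl → trans (put-lower M j x y refl) ey }
    ; other = λ a l ne → put-other M j x y ne
    }

  keep-shifted : ∀ (M : Matrix (suc m)) j {δ : ℕ → ℤ} → δ j ≡ 0ℤ → Shifted ι (_≡ j) δ M M
  keep-shifted M j {δ} eq = record
    { upper = λ { _ refl → sym (trans (cong (λ z → ent M ι j + z) eq) (ℤ.+-identityʳ (ent M _ j))) }
    ; lower = λ { _ refl → sym (trans (cong (λ z → ent M (suc ι) j - z) eq) (ℤ.+-identityʳ (ent M _ j))) }
    ; other = λ _ _ _ → refl
    }

-- Running maxima and minima

runMax : (ℕ → ℤ) → ℕ → ℤ
runMax c zero    = 0ℤ
runMax c (suc j) = runMax c j ⊔ c (suc j)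

-- Indexed by the distance to the column in which the minimum starts with d.
runMin : ℤ → (ℕ → ℤ) → ℕ → ℤ
runMin d g zero    = d
runMin d g (suc t) = runMin d g t ⊓ g (suc t)

record RunningMax (k : ℕ) (c μ : ℕ → ℤ) : Set where
  field
    start : μ 0 ≡ 0ℤ
    mono  : ∀ j → j < k → μ j ≤ μ (suc j)
    above : ∀ j → j ℕ.≤ k → c j ≤ μ j
    tight : ∀ j → j < k → μ (suc j) ≡ μ j ⊎ (μ j ≡ c j × μ (suc j) ≡ c (suc j))

record RunningMin (k : ℕ) (d : ℤ) (g ν : ℕ → ℤ) : Set where
  field
    start : ν k ≡ d
    mono  : ∀ j → j < k → ν j ≤ ν (suc j)
    below : ∀ j → j ℕ.≤ k → ν j ≤ g j
    tight : ∀ j → j < k → ν (suc j) ≡ ν j ⊎ (ν j ≡ g j × ν (suc j) ≡ g (suc j))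

module _ {k : ℕ} {c μ : ℕ → ℤ} (μ-max : RunningMax k c μ) where
  open RunningMax μ-max

  max-≥0 : ∀ j → j ℕ.≤ k → 0ℤ ≤ μ j
  max-≥0 zero    _   = ℤ.≤-reflexive (sym start)
  max-≥0 (suc j) j<k = ℤ.≤-trans (max-≥0 j (ℕ.<⇒≤ j<k)) (mono j j<k)

  max-least : (m : ℕ → ℤ) → 0ℤ ≤ m 0 → (∀ j → j < k → m j ≤ m (suc j)) →
              (∀ j → j ℕ.≤ k → c j ≤ m j) → ∀ j → j ℕ.≤ k → μ j ≤ m j
  max-least m m₀ m-mono m-above zero    _   = ℤ.≤-trans (ℤ.≤-reflexive start) m₀
  max-least m m₀ m-mono m-above (suc j) j<k with tight j j<k
  ... | inj₁ eq       = ℤ.≤-trans (ℤ.≤-reflexive eq) (ℤ.≤-trans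
                          (max-least m m₀ m-mono m-above j (ℕ.<⇒≤ j<k)) (m-mono j j<k))
  ... | inj₂ (_ , eq) = ℤ.≤-trans (ℤ.≤-reflexive eq) (m-above (suc j) j<k)

down-ind : ∀ {k} (P : ℕ → Set) → P k → (∀ j → j < k → P (suc j) → P j) →
           ∀ j → j ℕ.≤ k → P j
down-ind {k} P base step j j≤k = subst P (ℕ.m∸[m∸n]≡n j≤k) (go (k ∸ j) (ℕ.m∸n≤m k j))
  where
  go : ∀ t → t ℕ.≤ k → P (k ∸ t)
  go zero    _   = base
  go (suc t) t<k = step (k ∸ suc t) (ℕ.∸-monoʳ-< ℕ.z<s t<k)
    (subst P (ℕ.+-∸-assoc 1 t<k) (go t (ℕ.<⇒≤ t<k)))

module _ {k : ℕ} {d : ℤ} {g ν : ℕ → ℤ} (ν-min : RunningMin k d g ν) where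
  open RunningMin ν-min

  min-greatest : (m : ℕ → ℤ) → m k ≤ d → (∀ j → j < k → m j ≤ m (suc j)) →
                 (∀ j → j ℕ.≤ k → m j ≤ g j) → ∀ j → j ℕ.≤ k → m j ≤ ν j
  min-greatest m m≤d m-mono m-below =
    down-ind (λ j → m j ≤ ν j) (ℤ.≤-trans m≤d (ℤ.≤-reflexive (sym start))) step
    where
    step : ∀ j → j < k → m (suc j) ≤ ν (suc j) → m j ≤ ν j
    step j j<k ih with tight j j<k
    ... | inj₁ eq       = ℤ.≤-trans (m-mono j j<k) (ℤ.≤-trans ih (ℤ.≤-reflexive eq))
    ... | inj₂ (eq , _) = ℤ.≤-trans (m-below j (ℕ.<⇒≤ j<k)) (ℤ.≤-reflexive (sym eq))

-- The two operations on a pair of rows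

-- The values of cur in untangle and in cliffify.
excess gap : Vec (Vec ℤ p) n → ℕ → ℕ → ℤ
excess B i j = ht B i j - ht B (suc i) j + 1ℤ
gap    B i j = ht B (suc i) j - ht B i j - 1ℤ

excess-suc : (B : Vec (Vec ℤ p) n) (i j : ℕ) →
              excess B i j + ent B (suc i) j - ent B i j ≡ excess B i (suc j)
excess-suc B i j = eq (ht B i j) (ht B (suc i) j) (ent B i j) (ent B (suc i) j)
  where eq : ∀ a b x y → (a - b + 1ℤ) + y - x ≡ (a - x) - (b - y) + 1ℤ
        eq = solve-∀

gap-suc : (B : Vec (Vec ℤ p) n) (i j : ℕ) →
          gap B i (suc j) + ent B (suc i) j - ent B i j ≡ gap B i j
gap-suc B i j = eq (ht B i j) (ht B (suc i) j) (ent B i j) (ent B (suc i) j)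
  where eq : ∀ a b x y → ((b - y) - (a - x) - 1ℤ) + y - x ≡ b - a - 1ℤ
        eq = solve-∀

excess-0 : (B : Vec (Vec ℤ p) n) (i : ℕ) → excess B i 0 ≡ 0ℤ
excess-0 B i = eq (+ i)
  where eq : ∀ a → a - (1ℤ + a) + 1ℤ ≡ 0ℤ
        eq = solve-∀

gap-0 : (B : Vec (Vec ℤ p) n) (i : ℕ) → gap B i 0 ≡ 0ℤ
gap-0 B i = eq (+ i)
  where eq : ∀ a → (1ℤ + a) - a - 1ℤ ≡ 0ℤ
        eq = solve-∀

module _ {m : ℕ} (i : Fin m) (k : Fin (suc m)) where
  open TwoRows i
  private
    K : ℕ
    K = toℕ k

  record Untangled (BD BD′ : Pair (suc m)) : Set where
    private
      B = proj₁ BD ; D = proj₂ BD ; B′ = proj₁ BD′ ; D′ = proj₂ BD′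
    field
      μ       : ℕ → ℤ
      μ-max   : RunningMax K (excess B ι) μ
      shifted : Shifted ι (_< K) (λ l → μ (suc l) - μ l) B B′
      bits    : Bits B′
      D-upper : ent D′ ι K ≡ ent D ι K - μ K
      D-lower : ent D′ (suc ι) K ≡ μ K
      D-other : ∀ {a b} → (a ≢ ι × a ≢ suc ι) ⊎ b ≢ K → ent D′ a b ≡ ent D a b

  record Cliffified (s s′ : State (suc m)) : Set where
    private
      B = proj₁ (proj₁ s) ; D = proj₂ (proj₁ s) ; h = proj₂ s
      B′ = proj₁ (proj₁ s′) ; D′ = proj₂ (proj₁ s′) ; h′ = proj₂ s′
      d = ent D (suc ι) K
    field
      ν       : ℕ → ℤ
      ν-min   : RunningMin K d (gap B ι) ν
      shifted : Shifted ι (_< K) (λ l → ν l - ν (suc l)) B B′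
      bits    : Bits B′
      D-upper : ent D′ ι K ≡ ent D ι K + d
      D-lower : ent D′ (suc ι) K ≡ 0ℤ
      D-other : ∀ {a b} → (a ≢ ι × a ≢ suc ι) ⊎ b ≢ K → ent D′ a b ≡ ent D a b
      h-upper : at h′ ι ≡ at h ι + d
      h-lower : at h′ (suc ι) ≡ at h (suc ι) - d
      h-other : ∀ {a} → a ≢ ι → a ≢ suc ι → at h′ a ≡ at h a

  untangleStep-spec :
    ∀ {B c M j x y} → Bits B → c ≤ M → toℕ j ≡ x →
    c + ent B (suc ι) x - ent B ι x ≡ y → (δ : ℕ → ℤ) → δ x ≡ M ⊔ y - M →
    let (B′ , c′ , M′) = untangleStep i j (B , c , M) in
    Shifted ι (_≡ x) δ B B′ × Bits B′ × c′ ≡ y × M′ ≡ M ⊔ y × y ≤ M ⊔ y ×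
    (M ⊔ y ≡ M ⊎ (M ≡ c × M ⊔ y ≡ y))
  untangleStep-spec {B} {c} {M} {j} bits c≤M refl refl δ δ≡
    rewrite at-upper B j | at-lower B j
    with M ℤ.<? c + ent B (suc ι) (toℕ j) - ent B ι (toℕ j)
  ... | no ¬lt = keep-shifted B (toℕ j) (trans δ≡ (trans (cong (_- M) M⊔) (ℤ.+-inverseʳ M)))
               , bits , refl , sym M⊔ , ℤ.i≤j⊔i M _ , inj₁ M⊔
    where M⊔ = ℤ.i≥j⇒i⊔j≡i (ℤ.≮⇒≥ ¬lt)
  ... | yes lt with jump-up (bits ι (toℕ j)) (bits (suc ι) (toℕ j)) c≤M lt
  ... | x≡0 , y≡1 , c≡M =
        put-shifted B j 1ℤ 0ℤ (cong₂ _+_ (sym x≡0) (sym δ≡1)) (cong₂ _-_ (sym y≡1) (sym δ≡1))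
      , bits-set (set (inject₁ i) j 1ℤ B) (suc i) j (inj₁ refl) 
          (bits-set B (inject₁ i) j (inj₂ refl) bits)
      , refl , sym M⊔ , ℤ.i≤j⊔i M _ , inj₂ (sym c≡M , M⊔)
    where
    M⊔ = ℤ.i≤j⇒i⊔j≡j (ℤ.<⇒≤ lt)
    eq : ∀ z → z + 1ℤ - 0ℤ - z ≡ 1ℤ
    eq = solve-∀
    δ≡1 : δ (toℕ j) ≡ 1ℤ
    δ≡1 = trans δ≡ (trans (cong (_- M) M⊔)
          (trans (cong₂ (λ u v → u - v - M) (cong₂ _+_ c≡M y≡1) x≡0) (eq M)))

  untangle-spec : ∀ {B D} → Bits B → Untangled (B , D) (untangle i k (B , D))
  untangle-spec {B} {D} bits = record
    { μ       = μ
    ; μ-max   = record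
      { start = refl
      ; mono  = λ j _ → ℤ.i≤i⊔j (μ j) (c (suc j))
      ; above = above
      ; tight = tight
      }
    ; shifted = proj₁ loop
    ; bits    = proj₁ (proj₂ loop)
    ; D-upper = trans (put-upper D k _ _ refl) (cong₂ _-_ (at-upper D k) d≡)
    ; D-lower = trans (put-lower D k _ _ refl) d≡
    ; D-other = put-other D k _ _
    }
    where
    c μ δ : ℕ → ℤ
    c = excess B ι
    μ = runMax c
    δ l = μ (suc l) - μ l

    Inv : ℕ → Matrix (suc m) × ℤ × ℤ → Set
    Inv j (B′ , c′ , M) = Shifted ι (_< j) δ B B′ × Bits B′ × c′ ≡ c j × M ≡ μ j ×
      (∀ l → l ℕ.≤ j → c l ≤ μ l) ×
      (∀ l → l < j → μ (suc l) ≡ μ l ⊎ (μ l ≡ c l × μ (suc l) ≡ c (suc l)))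

    inv : Inv K (forUp K (untangleStep i ∘ inject) (B , 0ℤ , 0ℤ))
    inv = forUp-ind K Inv
      ( record { upper = λ _ () ; lower = λ _ () ; other = λ _ _ _ → refl }
      , bits , sym (excess-0 B ι) , refl
      , (λ { zero _ → ℤ.≤-reflexive (excess-0 B ι) }) , λ _ () )
      λ { j (B′ , _ , _) (sh , bits′ , refl , refl , ab , ti) →
        let J = toℕ j
            (sh′ , bits″ , c≡ , M≡ , le , t) =
              untangleStep-spec {x = J} bits′ (ab J ℕ.≤-refl) (Fin.toℕ-inject j)
                (trans (cong₂ (λ u v → c J + u - v)
                  (Shifted.other sh (suc ι) J (inj₂ (ℕ.<-irrefl refl)))
                  (Shifted.other sh ι J (inj₂ (ℕ.<-irrefl refl)))) (excess-suc B ι J))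
                δ refl
        in shifted-⊎ sh sh′ (ℕ.<-irrefl refl) (ℕ.n<1+n J)
             (λ l l≢J → ℕ.m<n⇒m<1+n , λ l<1+J → ℕ.≤∧≢⇒< (ℕ.≤-pred l<1+J) l≢J)
         , bits″ , c≡ , M≡
         , (λ l l≤ → extend≤ (λ l → c l ≤ μ l) ab le l l≤)
         , (λ l l< → extend< _ ti t l l<) }
      where
      extend< : ∀ {j} (P : ℕ → Set) → (∀ l → l < j → P l) → P j → ∀ l → l < suc j → P l
      extend< {j} P all last l l< with l ℕ.≟ j
      ... | yes refl = last
      ... | no l≢j   = all l (ℕ.≤∧≢⇒< (ℕ.≤-pred l<) l≢j)
      extend≤ : ∀ {j} (P : ℕ → Set) → (∀ l → l ℕ.≤ j → P l) → P (suc j) →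
                ∀ l → l ℕ.≤ suc j → P l
      extend≤ {j} P all last l l≤ with l ℕ.≟ suc j
      ... | yes refl = last
      ... | no l≢    = all l (ℕ.≤-pred (ℕ.≤∧≢⇒< l≤ l≢))

    loop = inv
    d≡    = proj₁ (proj₂ (proj₂ (proj₂ loop)))
    above = proj₁ (proj₂ (proj₂ (proj₂ (proj₂ loop))))
    tight = proj₂ (proj₂ (proj₂ (proj₂ (proj₂ loop))))

  cliffifyStep-spec :
    ∀ {B g M j x y} → Bits B → M ≤ g → toℕ j ≡ x →
    g + ent B (suc ι) x - ent B ι x ≡ y → (δ : ℕ → ℤ) → δ x ≡ M ⊓ y - M →
    let (B′ , g′ , M′) = cliffifyStep i j (B , g , M) in
    Shifted ι (_≡ x) δ B B′ × Bits B′ × g′ ≡ y × M′ ≡ M ⊓ y × M ⊓ y ≤ y ×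
    (M ≡ M ⊓ y ⊎ (M ⊓ y ≡ y × M ≡ g))
  cliffifyStep-spec {B} {g} {M} {j} bits M≤g refl refl δ δ≡
    rewrite at-upper B j | at-lower B j
    with g + ent B (suc ι) (toℕ j) - ent B ι (toℕ j) ℤ.<? M
  ... | no ¬lt = keep-shifted B (toℕ j) (trans δ≡ (trans (cong (_- M) M⊓) (ℤ.+-inverseʳ M)))
               , bits , refl , sym M⊓ , ℤ.i⊓j≤j M _ , inj₁ (sym M⊓)
    where M⊓ = ℤ.i≤j⇒i⊓j≡i (ℤ.≮⇒≥ ¬lt)
  ... | yes lt with jump-down (bits ι (toℕ j)) (bits (suc ι) (toℕ j)) M≤g lt
  ... | x≡1 , y≡0 , g≡M =
        put-shifted B j 0ℤ 1ℤ (cong₂ _+_ (sym x≡1) (sym δ≡-1)) (cong₂ _-_ (sym y≡0) (sym δ≡-1))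
      , bits-set (set (inject₁ i) j 0ℤ B) (suc i) j (inj₂ refl)
          (bits-set B (inject₁ i) j (inj₁ refl) bits)
      , refl , sym M⊓ , ℤ.i⊓j≤j M _ , inj₂ (M⊓ , sym g≡M)
    where
    M⊓ = ℤ.i≥j⇒i⊓j≡j (ℤ.<⇒≤ lt)
    eq : ∀ z → z + 0ℤ - 1ℤ - z ≡ -1ℤ
    eq = solve-∀
    δ≡-1 : δ (toℕ j) ≡ -1ℤ
    δ≡-1 = trans δ≡ (trans (cong (_- M) M⊓)
           (trans (cong₂ (λ u v → u - v - M) (cong₂ _+_ g≡M y≡0) x≡1) (eq M)))

  cliffify-spec : ∀ {B D h} → Bits B → at h (suc ι) - at h ι - 1ℤ ≡ gap B ι K →
                  ent D (suc ι) K ≤ gap B ι K →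
                  Cliffified ((B , D) , h) (cliffify i k ((B , D) , h))
  cliffify-spec {B} {D} {h} bits h≡ d≤ = record
    { ν       = ν
    ; ν-min   = record
      { start = start
      ; mono  = λ j j<K → ℤ.≤-trans (ℤ.≤-reflexive (ν-step j j<K)) (ℤ.i⊓j≤i _ (g j))
      ; below = λ j → below j z≤n
      ; tight = λ j → tight j z≤n
      }
    ; shifted = record
      { upper = λ l l<K → Shifted.upper sh l (z≤n , l<K)
      ; lower = λ l l<K → Shifted.lower sh l (z≤n , l<K)
      ; other = λ { a l (inj₁ ne) → Shifted.other sh a l (inj₁ ne)
                  ; a l (inj₂ l≮K) → Shifted.other sh a l (inj₂ (l≮K ∘ proj₂)) }
      }
    ; bits    = proj₁ (proj₂ loop)
    ; D-upper = trans (ent-set D₁ (inject₁ i) k _ ι≡ refl)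
        (cong₂ _+_ (trans (at-upper D₁ k)
          (ent-set-other D (suc i) k 0ℤ (inj₁ (ℕ.<⇒≢ (ℕ.n<1+n ι))))) (at-lower D k))
    ; D-lower = trans (ent-set-other D₁ (inject₁ i) k _
                  (inj₁ λ e → ℕ.<⇒≢ (ℕ.n<1+n ι) (sym (trans e (sym ι≡)))))
                  (ent-set D (suc i) k 0ℤ refl refl)
    ; D-other = λ
      { (inj₁ (p , q)) → trans (ent-set-other D₁ (inject₁ i) k _ (inj₁ λ e → p (trans e (sym ι≡))))
                               (ent-set-other D (suc i) k 0ℤ (inj₁ q))
      ; (inj₂ p) → trans (ent-set-other D₁ (inject₁ i) k _ (inj₂ p))
                         (ent-set-other D (suc i) k 0ℤ (inj₂ p)) }
    ; h-upper = trans (cong (at (h₁ [ inject₁ i ]≔ _)) ι≡) (trans (at-≔ h₁ (inject₁ i) _)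
        (cong₂ _+_ (trans (sym (at-! h₁ (inject₁ i)))
           (trans (at-≔-other h (suc i) _ (ℕ.<⇒≢ (ℕ.n<1+n ι) ∘ trans ι≡))
             (cong (at h) (sym ι≡)))) (at-lower D k)))
    ; h-lower = trans (at-≔-other h₁ (inject₁ i) _
                   λ e → ℕ.<⇒≢ (ℕ.n<1+n ι) (sym (trans e (sym ι≡))))
                 (trans (at-≔ h (suc i) _) (cong₂ _-_ (sym (at-! h (suc i))) (at-lower D k)))
    ; h-other = λ p q → trans (at-≔-other h₁ (inject₁ i) _ λ e → p (trans e (sym ι≡)))
                              (at-≔-other h (suc i) _ q)
    }
    where
    d : ℤ
    d = ent D (suc ι) K
    D₁ = set (suc i) k 0ℤ D
    h₁ = h [ suc i ]≔ (h ! suc i - D ! suc i ! k)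
    g ν δ : ℕ → ℤ
    g = gap B ι
    ν j = runMin d (λ t → g (K ∸ t)) (K ∸ j)
    δ l = ν l - ν (suc l)

    ν-step : ∀ j → j < K → ν j ≡ ν (suc j) ⊓ g j
    ν-step j j<K = trans (cong (runMin d _) K∸j≡) (cong (λ z → ν (suc j) ⊓ g z)
      (trans (cong (K ∸_) (sym K∸j≡)) (ℕ.m∸[m∸n]≡n (ℕ.<⇒≤ j<K))))
      where K∸j≡ = ℕ.+-∸-assoc 1 j<K

    Inv : ℕ → Matrix (suc m) × ℤ × ℤ → Set
    Inv j (B′ , g′ , M) =
      Shifted ι (λ l → j ℕ.≤ l × l < K) δ B B′ × Bits B′ × g′ ≡ g j × M ≡ ν j ×
      (∀ l → j ℕ.≤ l → l ℕ.≤ K → ν l ≤ g l) ×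
      (∀ l → j ℕ.≤ l → l < K → ν (suc l) ≡ ν l ⊎ (ν l ≡ g l × ν (suc l) ≡ g (suc l)))

    extend : ∀ {j} (P : ℕ → Set) → P j → (∀ l → suc j ℕ.≤ l → P l) → ∀ l → j ℕ.≤ l → P l
    extend {j} P first all l j≤l with j ℕ.≟ l
    ... | yes refl = first
    ... | no j≢l   = all l (ℕ.≤∧≢⇒< j≤l j≢l)

    start : ν K ≡ d
    start = cong (runMin d _) (ℕ.n∸n≡0 K)

    loop : Inv 0 (forDown K (cliffifyStep i ∘ inject)
                    (B , h ! suc i - h ! inject₁ i - 1ℤ , D ! suc i ! k))
    loop = forDown-ind K Inv
      ( record { upper = λ l p → ⊥-elim (ℕ.<⇒≱ (proj₂ p) (proj₁ p))
               ; lower = λ l p → ⊥-elim (ℕ.<⇒≱ (proj₂ p) (proj₁ p))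
               ; other = λ _ _ _ → refl }
      , bits
      , trans (cong₂ (λ u v → u - v - 1ℤ) (sym (at-! h (suc i)))
          (trans (sym (at-! h (inject₁ i))) (cong (at h) (sym ι≡)))) h≡
      , trans (at-lower D k) (sym start)
      , (λ l K≤l l≤K → subst (λ z → ν z ≤ g z) (ℕ.≤-antisym K≤l l≤K)
           (ℤ.≤-trans (ℤ.≤-reflexive start) d≤))
      , λ l K≤l l<K → ⊥-elim (ℕ.<⇒≱ l<K K≤l) )
      λ { j (B′ , _ , _) (sh , bits′ , refl , refl , be , ti) →
        let J = toℕ j
            J<K = Fin.toℕ<n j
            (sh′ , bits″ , g≡ , M≡ , le , t) =
              cliffifyStep-spec {x = J} bits′ (be (suc J) ℕ.≤-refl J<K) (Fin.toℕ-inject j)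
                (trans (cong₂ (λ u v → g (suc J) + u - v)
                  (Shifted.other sh (suc ι) J (inj₂ (ℕ.<-irrefl refl ∘ proj₁)))
                  (Shifted.other sh ι J (inj₂ (ℕ.<-irrefl refl ∘ proj₁)))) (gap-suc B ι J))
                δ (cong (_- ν (suc J)) (ν-step J J<K))
            ν≡ = ν-step J J<K
        in shifted-⊎ sh sh′ (ℕ.<-irrefl refl ∘ proj₁) (ℕ.≤-refl , J<K)
             (λ l l≢J → (λ (p , q) → ℕ.<⇒≤ p , q)
                      , λ (p , q) → ℕ.≤∧≢⇒< p (l≢J ∘ sym) , q)
         , bits″ , g≡ , trans M≡ (sym ν≡)
         , extend (λ l → l ℕ.≤ K → ν l ≤ g l)
             (λ _ → ℤ.≤-trans (ℤ.≤-reflexive ν≡) le) be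
         , extend _ (λ _ → tight′ ν≡ t) ti }
      where
      tight′ : ∀ {a b c e w} → a ≡ w → b ≡ w ⊎ (w ≡ c × b ≡ e) → b ≡ a ⊎ (a ≡ c × b ≡ e)
      tight′ refl t = t

    sh    = proj₁ loop
    below = proj₁ (proj₂ (proj₂ (proj₂ (proj₂ loop))))
    tight = proj₂ (proj₂ (proj₂ (proj₂ (proj₂ loop))))

module _ {i K : ℕ} {δ : ℕ → ℤ} {B B′ : Matrix n} (s : Shifted i (_< K) δ B B′)
         (μ : ℕ → ℤ) (μ₀ : μ 0 ≡ 0ℤ) (δ≡ : ∀ l → δ l ≡ μ (suc l) - μ l) where
  open Shifted s

  shifted-ht-upper : ∀ j → j ℕ.≤ K → ht B′ i j ≡ ht B i j - μ j
  shifted-ht-upper zero    _   = trans (eq (+ i)) (cong (λ z → + i - z) (sym μ₀))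
    where eq : ∀ x → x ≡ x - 0ℤ
          eq = solve-∀
  shifted-ht-upper (suc j) j<K =
    trans (cong₂ _-_ (shifted-ht-upper j (ℕ.<⇒≤ j<K))
                     (trans (upper j j<K) (cong (λ z → ent B i j + z) (δ≡ j))))
          (eq (ht B i j) (μ j) (ent B i j) (μ (suc j)))
    where eq : ∀ a b x y → (a - b) - (x + (y - b)) ≡ (a - x) - y
          eq = solve-∀

  shifted-ht-lower : ∀ j → j ℕ.≤ K → ht B′ (suc i) j ≡ ht B (suc i) j + μ j
  shifted-ht-lower zero    _   =
    trans (sym (ℤ.+-identityʳ (+ suc i))) (cong (λ z → + suc i + z) (sym μ₀))
  shifted-ht-lower (suc j) j<K =
    trans (cong₂ _-_ (shifted-ht-lower j (ℕ.<⇒≤ j<K))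
                     (trans (lower j j<K) (cong (λ z → ent B (suc i) j - z) (δ≡ j))))
          (eq (ht B (suc i) j) (μ j) (ent B (suc i) j) (μ (suc j)))
    where eq : ∀ a b x y → (a + b) - (x - (y - b)) ≡ (a - x) + y
          eq = solve-∀

shifted-ht-other : ∀ {i R δ} {B B′ : Matrix n} → Shifted i R δ B B′ →
                   ∀ {a} → a ≢ i → a ≢ suc i → ∀ j → ht B′ a j ≡ ht B a j
shifted-ht-other {B = B} {B′} s {a} p q j =
  ht-cong B′ B a j λ l _ → Shifted.other s a l (inj₁ (p , q))

shifted-cancel : ∀ {i K δ δ′} {B B′ B″ : Matrix n} → Shifted i (_< K) δ B B′ →
                 Shifted i (_< K) δ′ B′ B″ → (∀ l → l < K → δ l + δ′ l ≡ 0ℤ) → B″ ≡ B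
shifted-cancel {i = i} {K} {δ} {δ′} {B} {B′} {B″} s s′ opp = ent-ext B″ B same
  where
  module S = Shifted s
  module S′ = Shifted s′
  eq₁ : ∀ x u v → x + u + v ≡ x + (u + v)
  eq₁ = solve-∀
  eq₂ : ∀ x u v → x - u - v ≡ x - (u + v)
  eq₂ = solve-∀
  same : ∀ a b → ent B″ a b ≡ ent B a b
  same a b with a ℕ.≟ i | a ℕ.≟ suc i | b ℕ.<? K
  ... | _        | _        | no b≮K =
    trans (S′.other a b (inj₂ b≮K)) (S.other a b (inj₂ b≮K))
  ... | no a≢    | no a≢′   | yes _ =
    trans (S′.other a b (inj₁ (a≢ , a≢′))) (S.other a b (inj₁ (a≢ , a≢′)))
  ... | yes refl | _        | yes b<K =
    trans (S′.upper b b<K) (trans (cong (_+ δ′ b) (S.upper b b<K))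
      (trans (eq₁ (ent B a b) (δ b) (δ′ b))
        (trans (cong (λ z → ent B a b + z) (opp b b<K)) (ℤ.+-identityʳ (ent B a b)))))
  ... | no _     | yes refl | yes b<K =
    trans (S′.lower b b<K) (trans (cong (_- δ′ b) (S.lower b b<K))
      (trans (eq₂ (ent B a b) (δ b) (δ′ b))
        (trans (cong (λ z → ent B a b - z) (opp b b<K)) (ℤ.+-identityʳ (ent B a b)))))

module Inversion {m : ℕ} (i : Fin m) (k : Fin (suc m)) where
  open TwoRows i using (ι)
  private
    K : ℕ
    K = toℕ k

  module Untangled-ht {BD BD′} (u : Untangled i k BD BD′) where
    open Untangled u public
    open RunningMax μ-max public
    private B = proj₁ BD ; B′ = proj₁ BD′

    ht-upper : ∀ j → j ℕ.≤ K → ht B′ ι j ≡ ht B ι j - μ j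
    ht-upper = shifted-ht-upper shifted μ start λ _ → refl

    ht-lower : ∀ j → j ℕ.≤ K → ht B′ (suc ι) j ≡ ht B (suc ι) j + μ j
    ht-lower = shifted-ht-lower shifted μ start λ _ → refl

    gap≡ : ∀ j → j ℕ.≤ K → gap B′ ι j ≡ μ j + μ j - excess B ι j
    gap≡ j j≤K = trans (cong₂ (λ x y → x - y - 1ℤ) (ht-lower j j≤K) (ht-upper j j≤K))
                       (eq (ht B (suc ι) j) (ht B ι j) (μ j))
      where eq : ∀ x y z → (x + z) - (y - z) - 1ℤ ≡ z + z - (y - x + 1ℤ)
            eq = solve-∀

    μ≤gap : ∀ j → j ℕ.≤ K → μ j ≤ gap B′ ι j
    μ≤gap j j≤K = subst (μ j ≤_) (sym (gap≡ j j≤K))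
                    (≤-from (above j j≤K) (eq (μ j) (excess B ι j)))
      where eq : ∀ x y → x + x - y - x ≡ x - y
            eq = solve-∀

  module Cliffified-ht {s s′} (c : Cliffified i k s s′)
                       (ν₀ : Cliffified.ν c 0 ≡ 0ℤ) where
    open Cliffified c public
    open RunningMin ν-min public
    private B = proj₁ (proj₁ s) ; B′ = proj₁ (proj₁ s′)

    private
      eq : ∀ x y → x - y ≡ - y - - x
      eq = solve-∀
      eq⁻ : ∀ x y → x - - y ≡ x + y
      eq⁻ = solve-∀

    ht-upper : ∀ j → j ℕ.≤ K → ht B′ ι j ≡ ht B ι j + ν j
    ht-upper j j≤K = trans
      (shifted-ht-upper shifted (-_ ∘ ν) (cong -_ ν₀) (λ l → eq (ν l) (ν (suc l))) j j≤K)
      (eq⁻ (ht B ι j) (ν j))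

    ht-lower : ∀ j → j ℕ.≤ K → ht B′ (suc ι) j ≡ ht B (suc ι) j - ν j
    ht-lower =
      shifted-ht-lower shifted (-_ ∘ ν) (cong -_ ν₀) (λ l → eq (ν l) (ν (suc l)))

    excess≡ : ∀ j → j ℕ.≤ K → excess B′ ι j ≡ ν j + ν j - gap B ι j
    excess≡ j j≤K = trans (cong₂ (λ x y → x - y + 1ℤ) (ht-upper j j≤K) (ht-lower j j≤K))
                          (eq′ (ht B (suc ι) j) (ht B ι j) (ν j))
      where eq′ : ∀ x y z → (y + z) - (x - z) + 1ℤ ≡ z + z - (x - y - 1ℤ)
            eq′ = solve-∀

    excess≤ν : ∀ j → j ℕ.≤ K → excess B′ ι j ≤ ν j
    excess≤ν j j≤K = subst (_≤ ν j) (sym (excess≡ j j≤K))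
                       (≤-from (below j j≤K) (eq′ (ν j) (gap B ι j)))
      where eq′ : ∀ x y → x - (x + x - y) ≡ y - x
            eq′ = solve-∀

  same-entry : (D D′ D″ : Matrix (suc m)) →
    (∀ {a b} → (a ≢ ι × a ≢ suc ι) ⊎ b ≢ K → ent D′ a b ≡ ent D a b) →
    (∀ {a b} → (a ≢ ι × a ≢ suc ι) ⊎ b ≢ K → ent D″ a b ≡ ent D′ a b) →
    ent D″ ι K ≡ ent D ι K → ent D″ (suc ι) K ≡ ent D (suc ι) K → D″ ≡ D
  same-entry D D′ D″ other other′ up lo = ent-ext D″ D same
    where
    same : ∀ a b → ent D″ a b ≡ ent D a b
    same a b with a ℕ.≟ ι | a ℕ.≟ suc ι | b ℕ.≟ K
    ... | _        | _        | no b≢    = trans (other′ (inj₂ b≢)) (other (inj₂ b≢))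
    ... | no a≢    | no a≢′   | yes _    = trans (other′ (inj₁ (a≢ , a≢′))) (other (inj₁ (a≢ , a≢′)))
    ... | yes refl | _        | yes refl = up
    ... | no _     | yes refl | yes refl = lo

  -- Both sequences solve the recursion that defines the running minimum.
  cliffify∘untangle : ∀ {BD BD′ h s} (u : Untangled i k BD BD′) →
                      (c : Cliffified i k (BD′ , h) s) →
                      ent (proj₂ BD) (suc ι) K ≡ 0ℤ →
                      Cliffified.ν c 0 ≡ 0ℤ × proj₁ s ≡ BD
  cliffify∘untangle {BD@(B , D)} {B′ , D′} {h} {(B″ , D″) , _} u c D≡0 =
      trans (sym (μ≡ν 0 z≤n)) start
    , cong₂ _,_
        (shifted-cancel shifted C.shifted λ l l<K →
          trans (cong₂ (λ x y → (μ (suc l) - μ l) + (x - y)) (sym (μ≡ν l (ℕ.<⇒≤ l<K)))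
                       (sym (μ≡ν (suc l) l<K))) (eq (μ l) (μ (suc l))))
        (same-entry D D′ D″ D-other C.D-other
          (trans C.D-upper (trans (cong₂ _+_ D-upper D-lower) (eq′ (ent D ι K) (μ K))))
          (trans C.D-lower (sym D≡0)))
    where
    open Untangled-ht u
    module C = Cliffified c
    module M = RunningMin C.ν-min
    eq : ∀ x y → (y - x) + (x - y) ≡ 0ℤ
    eq = solve-∀
    eq′ : ∀ x y → (x - y) + y ≡ x
    eq′ = solve-∀
    ν≤μ : ∀ j → j ℕ.≤ K → C.ν j ≤ μ j
    ν≤μ = down-ind (λ j → C.ν j ≤ μ j) (ℤ.≤-reflexive (trans M.start D-lower)) step
      where
      eq″ : ∀ x → x + x - x ≡ x
      eq″ = solve-∀
      step : ∀ j → j < K → C.ν (suc j) ≤ μ (suc j) → C.ν j ≤ μ j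
      step j j<K ih with tight j j<K
      ... | inj₁ e = ℤ.≤-trans (M.mono j j<K) (ℤ.≤-trans ih (ℤ.≤-reflexive e))
      ... | inj₂ (e , _) = ℤ.≤-trans (M.below j (ℕ.<⇒≤ j<K)) (ℤ.≤-reflexive
              (trans (gap≡ j (ℕ.<⇒≤ j<K)) (trans (cong (λ z → μ j + μ j - z) (sym e)) (eq″ (μ j)))))
    μ≡ν : ∀ j → j ℕ.≤ K → μ j ≡ C.ν j
    μ≡ν j j≤K = ℤ.≤-antisym
      (min-greatest C.ν-min μ (ℤ.≤-reflexive (sym D-lower)) mono μ≤gap j j≤K) (ν≤μ j j≤K)

  untangle∘cliffify : ∀ {BD h s BD″} (c : Cliffified i k (BD , h) s) →
                      Cliffified.ν c 0 ≡ 0ℤ → Untangled i k (proj₁ s) BD″ → BD″ ≡ BD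
  untangle∘cliffify {BD@(B , D)} {h} {(B′ , D′) , _} {B″ , D″} c ν₀ u =
    cong₂ _,_
      (shifted-cancel shifted U.shifted λ l l<K →
          trans (cong₂ (λ x y → (ν l - ν (suc l)) + (x - y)) (μ≡ν (suc l) l<K)
                       (μ≡ν l (ℕ.<⇒≤ l<K))) (eq (ν (suc l)) (ν l)))
      (same-entry D D′ D″ D-other U.D-other
        (trans U.D-upper (trans (cong₂ _-_ D-upper μK) (eq′ (ent D ι K) (ent D (suc ι) K))))
        (trans U.D-lower μK))
    where
    open Cliffified-ht c ν₀
    module U = Untangled u
    module M = RunningMax U.μ-max
    eq : ∀ x y → (y - x) + (x - y) ≡ 0ℤ
    eq = solve-∀
    eq′ : ∀ x y → (x + y) - y ≡ x
    eq′ = solve-∀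
    ν≤μ : ∀ j → j ℕ.≤ K → ν j ≤ U.μ j
    ν≤μ zero    _   = ℤ.≤-reflexive (trans ν₀ (sym M.start))
    ν≤μ (suc j) j<K with tight j j<K
    ... | inj₁ e = ℤ.≤-trans (ℤ.≤-reflexive e)
                     (ℤ.≤-trans (ν≤μ j (ℕ.<⇒≤ j<K)) (M.mono j j<K))
    ... | inj₂ (_ , e) = ℤ.≤-trans (ℤ.≤-reflexive (sym (trans (excess≡ (suc j) j<K)
            (trans (cong (λ z → ν (suc j) + ν (suc j) - z) (sym e)) (eq″ (ν (suc j)))))))
            (M.above (suc j) j<K)
      where
      eq″ : ∀ x → x + x - x ≡ x
      eq″ = solve-∀
    μ≡ν : ∀ j → j ℕ.≤ K → U.μ j ≡ ν j
    μ≡ν j j≤K = ℤ.≤-antisym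
      (max-least U.μ-max ν (ℤ.≤-reflexive (sym ν₀)) mono excess≤ν j j≤K) (ν≤μ j j≤K)
    μK : U.μ K ≡ ent D (suc ι) K
    μK = trans (μ≡ν K ℕ.≤-refl) start

-- Families of paths in terms of the matrices

ent-out : (M : Vec (Vec ℤ p) n) {a b : ℕ} → n ℕ.≤ a → ent M a b ≡ 0ℤ
ent-out []      _           = refl
ent-out (_ ∷ M) (s≤s n≤a) = ent-out M n≤a

enter leave : Pair n → ℕ → ℕ → ℤ
enter BD a zero    = + a
enter BD a (suc j) = leave BD a j - ent (proj₁ BD) a j
leave BD a j       = enter BD a j - ent (proj₂ BD) a j

minus-0 : ∀ x {y} → y ≡ 0ℤ → x - y ≡ x
minus-0 x refl = ℤ.+-identityʳ x

enter-early : (BD : Pair n) (a j : ℕ) → (∀ b → b < j → ent (proj₂ BD) a b ≡ 0ℤ) →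
              enter BD a j ≡ ht (proj₁ BD) a j
enter-early BD a zero    D≡0 = refl
enter-early BD a (suc j) D≡0 = cong (_- ent (proj₁ BD) a j)
  (trans (minus-0 _ (D≡0 j ℕ.≤-refl)) (enter-early BD a j λ b b<j → D≡0 b (ℕ.m<n⇒m<1+n b<j)))

enter-cong : (BD BD′ : Pair n) {a : ℕ} (j : ℕ) →
             (∀ b → ent (proj₁ BD) a b ≡ ent (proj₁ BD′) a b) →
             (∀ b → ent (proj₂ BD) a b ≡ ent (proj₂ BD′) a b) →
             enter BD a j ≡ enter BD′ a j
enter-cong BD BD′ zero    eB eD = refl
enter-cong BD BD′ (suc j) eB eD = cong₂ _-_ (cong₂ _-_ (enter-cong BD BD′ j eB eD) (eD j)) (eB j)

enter-late : (BD BD′ : Pair n) {a K : ℕ} (j : ℕ) →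
             (∀ b → K ℕ.≤ b → ent (proj₁ BD) a b ≡ ent (proj₁ BD′) a b) →
             (∀ b → K < b → ent (proj₂ BD) a b ≡ ent (proj₂ BD′) a b) →
             leave BD a K ≡ leave BD′ a K → K < j → enter BD a j ≡ enter BD′ a j
enter-late BD BD′ {a} {K} (suc j) eB eD eK (s≤s K≤j) with ℕ.m≤n⇒m<n∨m≡n K≤j
... | inj₂ refl = cong₂ _-_ eK (eB K ℕ.≤-refl)
... | inj₁ K<j  = cong₂ _-_ (cong₂ _-_ (enter-late BD BD′ j eB eD eK K<j) (eD j K<j)) (eB j K≤j)

record Valid (k : ℕ) (BD : Pair n) : Set where
  private
    B = proj₁ BD
    D = proj₂ BD
  field
    bits     : Bits B
    B-lower  : ∀ a b → a ℕ.≤ b → ent B a b ≡ 0ℤ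
    D-nonneg : ∀ a b → 0ℤ ≤ ent D a b
    D-lower  : ∀ a b → a < b → ent D a b ≡ 0ℤ
    ends     : ∀ a → a < n → leave BD a a ≡ 0ℤ
    early    : ∀ a b → b < k → b < a → ent D a b ≡ 0ℤ
    order    : ∀ a b → k ℕ.≤ a → suc a < n → b ℕ.≤ a → 1ℤ + enter BD a b ≤ leave BD (suc a) b

  enter≡ht : ∀ {a j} → j ℕ.≤ k → j ℕ.≤ a → enter BD a j ≡ ht B a j
  enter≡ht {a} {j} j≤k j≤a = enter-early BD a j λ b b<j →
    early a b (ℕ.<-≤-trans b<j j≤k) (ℕ.<-≤-trans b<j j≤a)

  ht-order : ∀ {a j} → k ℕ.≤ a → suc a < n → j ℕ.≤ k →
             1ℤ + ht B a j ≤ ht B (suc a) j - ent D (suc a) j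
  ht-order {a} {j} k≤a a< j≤k =
    subst₂ (λ x y → 1ℤ + x ≤ y - ent D (suc a) j) (enter≡ht j≤k j≤a)
      (enter≡ht j≤k (ℕ.m≤n⇒m≤1+n j≤a)) (order a j k≤a a< j≤a)
    where j≤a = ℕ.≤-trans j≤k k≤a

ht-≥ : (B : Vec (Vec ℤ p) n) → Bits B → ∀ a j → + a - + j ≤ ht B a j
ht-≥ B bits a zero    = ℤ.≤-reflexive (ℤ.+-identityʳ (+ a))
ht-≥ B bits a (suc j) =
  ≤-from (ℤ.+-mono-≤ (ht-≥ B bits a j) (bit≤1 (bits a j))) (eq (+ a) (+ j) (ht B a j) (ent B a j))
  where eq : ∀ a j h x → (h - x) - (a - (1ℤ + j)) ≡ (h + 1ℤ) - ((a - j) + x)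
        eq = solve-∀

-- Combing

module Combing {m : ℕ} (k : Fin (suc m)) {BD₀ : Pair (suc m)}
               (valid : Valid (suc (toℕ k)) BD₀) where
  private
    K : ℕ
    K = toℕ k
    B₀ = proj₁ BD₀
    D₀ = proj₂ BD₀
    module V = Valid valid

  -- The lower bounds q of the combed paths: the given paths after row k, but in
  -- row k, where there is no disjointness to start with, the lowest possible path.
  low : ℕ → ℕ → ℤ
  low a j with a ℕ.≟ K
  ... | yes _ = + K - + j
  ... | no _  = ht B₀ a j

  low-K : ∀ j → low K j ≡ + K - + j
  low-K j with K ℕ.≟ K
  ... | yes _  = refl
  ... | no K≢K = ⊥-elim (K≢K refl)

  low-> : ∀ {a} j → K < a → low a j ≡ ht B₀ a j
  low-> {a} j K<a with a ℕ.≟ K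
  ... | yes refl = ⊥-elim (ℕ.<-irrefl refl K<a)
  ... | no _     = refl

  low≤ht : ∀ a j → low a j ≤ ht B₀ a j
  low≤ht a j with a ℕ.≟ K
  ... | yes refl = ht-≥ B₀ V.bits a j
  ... | no _     = ℤ.≤-refl

  low<ht : ∀ a j → K ℕ.≤ a → suc a < suc m → j ℕ.≤ K → 1ℤ + low a j ≤ ht B₀ (suc a) j
  low<ht a j K≤a a< j≤K with a ℕ.≟ K
  ... | yes refl = ≤-from (ht-≥ B₀ V.bits (suc a) j) (eq (ht B₀ (suc a) j) (+ a) (+ j))
    where eq : ∀ h a j → h - (1ℤ + (a - j)) ≡ h - ((1ℤ + a) - j)
          eq = solve-∀
  ... | no a≢K   = ℤ.≤-trans (V.ht-order K<a a< (ℕ.m≤n⇒m≤1+n j≤K))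
                     (ℤ.≤-reflexive (minus-0 _ (V.early (suc a) j (s≤s j≤K) (s≤s (ℕ.≤-trans j≤K K≤a)))))
    where K<a = ℕ.≤∧≢⇒< K≤a (a≢K ∘ sym)

  -- Rows before t are final, rows after t are untouched, and row t is the
  -- intermediate path.
  record Stage (t : ℕ) (BD : Pair (suc m)) : Set where
    private
      B = proj₁ BD
      D = proj₂ BD
    field
      bits   : Bits B
      B-same : ∀ a b → a < K ⊎ t < a ⊎ K ℕ.≤ b → ent B a b ≡ ent B₀ a b
      D-same : ∀ a b → a < K ⊎ b ≢ K → ent D a b ≡ ent D₀ a b
      D-col  : ∀ a → K ℕ.≤ a → a < suc m → ent D a K ≡ ht B a K - low a K
      upper  : ∀ a j → K ℕ.≤ a → a < t → j ℕ.≤ K → 1ℤ + ht B a j ≤ ht B₀ (suc a) j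
      lower  : ∀ a j → K ℕ.≤ a → j ℕ.≤ K → low a j ≤ ht B a j
      mono   : ∀ j → j < K → ht B t j - low t j ≤ ht B t (suc j) - low t (suc j)

    ht-later : ∀ {a} j → t < a → ht B a j ≡ ht B₀ a j
    ht-later {a} j t<a = ht-cong B B₀ a j λ l _ → B-same a l (inj₂ (inj₁ t<a))

    leave-col : ∀ {a} → K ℕ.≤ a → a < suc m → leave BD a K ≡ low a K
    leave-col {a} K≤a a<n = trans (cong₂ _-_ (enter-early BD a K λ b b<K →
        trans (D-same a b (inj₂ (ℕ.<⇒≢ b<K)))
              (V.early a b (ℕ.m<n⇒m<1+n b<K) (ℕ.<-≤-trans b<K K≤a))) (D-col a K≤a a<n))
      (eq (ht B a K) (low a K))
      where eq : ∀ x y → x - (x - y) ≡ y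
            eq = solve-∀

  first-stage : Stage K BD₀
  first-stage = record
    { bits   = V.bits
    ; B-same = λ _ _ _ → refl
    ; D-same = λ _ _ _ → refl
    ; D-col  = D-col
    ; upper  = λ a j K≤a a<K → ⊥-elim (ℕ.<⇒≱ a<K K≤a)
    ; lower  = λ a j _ _ → low≤ht a j
    ; mono   = λ j j<K → subst₂ (λ x y → ht B₀ K j - x ≤ ht B₀ K (suc j) - y)
        (sym (low-K j)) (sym (low-K (suc j)))
        (≤-from (bit≤1 (V.bits K j)) (eq (ht B₀ K j) (+ K) (+ j) (ent B₀ K j)))
    }
    where
    eq : ∀ h k j x → ((h - x) - (k - (1ℤ + j))) - (h - (k - j)) ≡ 1ℤ - x
    eq = solve-∀
    D-col : ∀ a → K ℕ.≤ a → a < suc m → ent D₀ a K ≡ ht B₀ a K - low a K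
    D-col a K≤a a<n with ℕ.m≤n⇒m<n∨m≡n K≤a
    ... | inj₁ K<a  = trans (V.early a K (ℕ.n<1+n K) K<a)
                        (sym (trans (cong (λ z → ht B₀ a K - z) (low-> K K<a)) (ℤ.+-inverseʳ (ht B₀ a K))))
    ... | inj₂ refl = trans (eq′ (enter BD₀ K K) (ent D₀ K K))
        (cong₂ _-_ (V.enter≡ht (ℕ.n≤1+n K) ℕ.≤-refl)
          (trans (V.ends K a<n) (sym (trans (low-K K) (ℤ.+-inverseʳ (+ K))))))
      where eq′ : ∀ x y → y ≡ x - (x - y)
            eq′ = solve-∀

  next-stage : ∀ {i BD BD′} → K ℕ.≤ toℕ i → Stage (toℕ i) BD → Untangled i k BD BD′ →
               Stage (suc (toℕ i)) BD′
  next-stage {i} {BD} {BD′} K≤ι stage u = record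
    { bits   = bits
    ; B-same = λ
      { a b (inj₁ a<K) →
          trans (other a b (inj₁ (before a<K))) (S.B-same a b (inj₁ a<K))
      ; a b (inj₂ (inj₁ 1+ι<a)) →
          let ι<a = ℕ.<-trans (ℕ.n<1+n ι) 1+ι<a in
          trans (other a b (inj₁ (ℕ.>⇒≢ ι<a , ℕ.>⇒≢ 1+ι<a))) (S.B-same a b (inj₂ (inj₁ ι<a)))
      ; a b (inj₂ (inj₂ K≤b)) →
          trans (other a b (inj₂ (ℕ.≤⇒≯ K≤b))) (S.B-same a b (inj₂ (inj₂ K≤b)))
      }
    ; D-same = λ
      { a b (inj₁ a<K) → trans (D-other (inj₁ (before a<K))) (S.D-same a b (inj₁ a<K))
      ; a b (inj₂ b≢K) → trans (D-other (inj₂ b≢K)) (S.D-same a b (inj₂ b≢K))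
      }
    ; D-col  = D-col
    ; upper  = upper
    ; lower  = lower
    ; mono   = λ j j<K → subst₂ _≤_ (μ≡ j (ℕ.<⇒≤ j<K)) (μ≡ (suc j) j<K) (mono j j<K)
    }
    where
    open Inversion.Untangled-ht i k u
    open Shifted shifted using (other)
    module S = Stage stage
    B = proj₁ BD
    B′ = proj₁ BD′
    ι = toℕ i
    ι<m : suc ι < suc m
    ι<m = s≤s (Fin.toℕ<n i)

    before : ∀ {a} → a < K → a ≢ ι × a ≢ suc ι
    before a<K = ℕ.<⇒≢ a<ι , ℕ.<⇒≢ (ℕ.m<n⇒m<1+n a<ι)
      where a<ι = ℕ.<-≤-trans a<K K≤ι

    ht-next : ∀ j → ht B (suc ι) j ≡ ht B₀ (suc ι) j
    ht-next j = S.ht-later j (ℕ.n<1+n ι)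

    low-next : ∀ j → low (suc ι) j ≡ ht B (suc ι) j
    low-next j = trans (low-> j (s≤s K≤ι)) (sym (ht-next j))

    μ≡ : ∀ j → j ℕ.≤ K → μ j ≡ ht B′ (suc ι) j - low (suc ι) j
    μ≡ j j≤K = trans (eq (ht B (suc ι) j) (μ j)) (cong₂ _-_ (sym (ht-lower j j≤K)) (sym (low-next j)))
      where eq : ∀ x y → y ≡ (x + y) - x
            eq = solve-∀

    μ≤ : ∀ j → j ℕ.≤ K → μ j ≤ ht B ι j - low ι j
    μ≤ = max-least μ-max (λ j → ht B ι j - low ι j)
      (ℤ.i≤j⇒0≤j-i (S.lower ι 0 K≤ι z≤n)) S.mono
      λ j j≤K → ≤-from (subst (1ℤ + low ι j ≤_) (sym (ht-next j)) (low<ht ι j K≤ι ι<m j≤K))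
                       (eq (ht B ι j) (low ι j) (ht B (suc ι) j))
      where eq : ∀ x l y → (x - l) - (x - y + 1ℤ) ≡ y - (1ℤ + l)
            eq = solve-∀

    D-col : ∀ a → K ℕ.≤ a → a < suc m → ent (proj₂ BD′) a K ≡ ht B′ a K - low a K
    D-col a K≤a a<n with a ℕ.≟ ι | a ℕ.≟ suc ι
    ... | yes refl | _        = trans D-upper (trans (cong (_- μ K) (S.D-col a K≤a a<n))
          (trans (eq (ht B a K) (low a K) (μ K)) (cong (_- low a K) (sym (ht-upper K ℕ.≤-refl)))))
      where eq : ∀ x l y → (x - l) - y ≡ (x - y) - l
            eq = solve-∀
    ... | no _     | yes refl = trans D-lower (μ≡ K ℕ.≤-refl)
    ... | no p     | no q     = trans (D-other (inj₁ (p , q))) (trans (S.D-col a K≤a a<n)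
          (cong (_- low a K) (sym (shifted-ht-other shifted p q K))))

    upper : ∀ a j → K ℕ.≤ a → a < suc ι → j ℕ.≤ K → 1ℤ + ht B′ a j ≤ ht B₀ (suc a) j
    upper a j K≤a a<1+ι j≤K with ℕ.m≤n⇒m<n∨m≡n (ℕ.≤-pred a<1+ι)
    ... | inj₁ a<ι  = subst (λ z → 1ℤ + z ≤ ht B₀ (suc a) j)
          (sym (shifted-ht-other shifted (ℕ.<⇒≢ a<ι) (ℕ.<⇒≢ a<1+ι) j)) (S.upper a j K≤a a<ι j≤K)
    ... | inj₂ refl = subst₂ (λ y z → 1ℤ + y ≤ z) (sym (ht-upper j j≤K)) (ht-next j)
          (≤-from (above j j≤K) (eq (ht B ι j) (ht B (suc ι) j) (μ j)))
      where eq : ∀ x y z → y - (1ℤ + (x - z)) ≡ z - (x - y + 1ℤ)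
            eq = solve-∀

    lower : ∀ a j → K ℕ.≤ a → j ℕ.≤ K → low a j ≤ ht B′ a j
    lower a j K≤a j≤K with a ℕ.≟ ι | a ℕ.≟ suc ι
    ... | yes refl | _        = subst (low a j ≤_) (sym (ht-upper j j≤K))
          (≤-from (μ≤ j j≤K) (eq (ht B a j) (low a j) (μ j)))
      where eq : ∀ x l y → (x - y) - l ≡ (x - l) - y
            eq = solve-∀
    ... | no _     | yes refl = ℤ.0≤i-j⇒j≤i (subst (0ℤ ≤_) (μ≡ j j≤K) (max-≥0 μ-max j j≤K))
    ... | no p     | no q     = 
          subst (low a j ≤_) (sym (shifted-ht-other shifted p q j)) (S.lower a j K≤a j≤K)

  last-stage : ∀ {BD} → Stage m BD → Valid K BD
  last-stage {BD} stage = record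
    { bits     = bits
    ; B-lower  = B-lower
    ; D-nonneg = D-nonneg
    ; D-lower  = λ a b a<b → trans (D-same a b (case-< a<b)) (V.D-lower a b a<b)
    ; ends     = ends
    ; early    = λ a b b<K b<a → trans (D-same a b (inj₂ (ℕ.<⇒≢ b<K))) (V.early a b (ℕ.m<n⇒m<1+n b<K) b<a)
    ; order    = order
    }
    where
    open Stage stage
    B = proj₁ BD
    D = proj₂ BD

    case-< : ∀ {a b} → a < b → a < K ⊎ b ≢ K
    case-< {a} {b} a<b with b ℕ.≟ K
    ... | yes refl = inj₁ a<b
    ... | no b≢K   = inj₂ b≢K

    B-lower : ∀ a b → a ℕ.≤ b → ent B a b ≡ 0ℤ
    B-lower a b a≤b with a ℕ.<? K
    ... | yes a<K = trans (B-same a b (inj₁ a<K)) (V.B-lower a b a≤b)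
    ... | no a≮K  = trans (B-same a b (inj₂ (inj₂ (ℕ.≤-trans (ℕ.≮⇒≥ a≮K) a≤b)))) (V.B-lower a b a≤b)

    D-nonneg : ∀ a b → 0ℤ ≤ ent D a b
    D-nonneg a b with a ℕ.<? K | b ℕ.≟ K | a ℕ.<? suc m
    ... | yes a<K | _        | _       = subst (0ℤ ≤_) (sym (D-same a b (inj₁ a<K))) (V.D-nonneg a b)
    ... | _       | no b≢K   | _       = subst (0ℤ ≤_) (sym (D-same a b (inj₂ b≢K))) (V.D-nonneg a b)
    ... | _       | _        | no a≮n  = ℤ.≤-reflexive (sym (ent-out D (ℕ.≮⇒≥ a≮n)))
    ... | no a≮K  | yes refl | yes a<n = subst (0ℤ ≤_) (sym (D-col a (ℕ.≮⇒≥ a≮K) a<n))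
          (ℤ.i≤j⇒0≤j-i (lower a K (ℕ.≮⇒≥ a≮K) ℕ.≤-refl))

    late : ∀ {a} j → K ℕ.≤ a → a < suc m → K < j → enter BD a j ≡ enter BD₀ a j
    late {a} j K≤a a<n = enter-late BD BD₀ j (λ b K≤b → B-same a b (inj₂ (inj₂ K≤b)))
      (λ b K<b → D-same a b (inj₂ (ℕ.>⇒≢ K<b)))
      (trans (leave-col K≤a a<n) (sym (Stage.leave-col first-stage K≤a a<n)))

    late-leave : ∀ {a} j → K ℕ.≤ a → a < suc m → K < j → leave BD a j ≡ leave BD₀ a j
    late-leave {a} j K≤a a<n K<j =
      cong₂ _-_ (late j K≤a a<n K<j) (D-same a j (inj₂ (ℕ.>⇒≢ K<j)))

    ends : ∀ a → a < suc m → leave BD a a ≡ 0ℤ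
    ends a a<n with ℕ.<-cmp a K
    ... | tri< a<K _ _  = trans (cong₂ _-_
          (enter-cong BD BD₀ a (λ b → B-same a b (inj₁ a<K)) (λ b → D-same a b (inj₁ a<K)))
          (D-same a a (inj₁ a<K))) (V.ends a a<n)
    ... | tri≈ _ refl _ = trans (leave-col ℕ.≤-refl a<n) (trans (low-K K) (ℤ.+-inverseʳ (+ K)))
    ... | tri> _ _ K<a  = trans (late-leave a (ℕ.<⇒≤ K<a) a<n K<a) (V.ends a a<n)

    enter≡ht : ∀ {a} j → K ℕ.≤ a → j ℕ.≤ K → enter BD a j ≡ ht B a j
    enter≡ht {a} j K≤a j≤K = enter-early BD a j λ b b<j →
      let b<K = ℕ.<-≤-trans b<j j≤K in
      trans (D-same a b (inj₂ (ℕ.<⇒≢ b<K))) (V.early a b (ℕ.m<n⇒m<1+n b<K) (ℕ.<-≤-trans b<K K≤a))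

    order : ∀ a b → K ℕ.≤ a → suc a < suc m → b ℕ.≤ a → 1ℤ + enter BD a b ≤ leave BD (suc a) b
    order a b K≤a a< b≤a with ℕ.<-cmp b K
    ... | tri< b<K _ _  = subst₂ (λ x y → 1ℤ + x ≤ y) (sym (enter≡ht b K≤a b≤K))
          (sym (trans (minus-0 _ (trans (D-same (suc a) b (inj₂ (ℕ.<⇒≢ b<K)))
                                        (V.early (suc a) b (ℕ.m<n⇒m<1+n b<K) (s≤s b≤a))))
                      (enter≡ht b (ℕ.m≤n⇒m≤1+n K≤a) b≤K)))
          (ℤ.≤-trans (upper a b K≤a (ℕ.≤-pred a<) b≤K)
            (ℤ.≤-trans (ℤ.≤-reflexive (sym (low-> b (s≤s K≤a))))
                       (lower (suc a) b (ℕ.m≤n⇒m≤1+n K≤a) b≤K)))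
      where b≤K = ℕ.<⇒≤ b<K
    ... | tri≈ _ refl _ = subst₂ (λ x y → 1ℤ + x ≤ y) (sym (enter≡ht b K≤a ℕ.≤-refl))
          (trans (sym (low-> b (s≤s K≤a))) (sym (leave-col (ℕ.m≤n⇒m≤1+n K≤a) a<)))
          (upper a b K≤a (ℕ.≤-pred a<) ℕ.≤-refl)
    ... | tri> _ _ K<b  = subst₂ (λ x y → 1ℤ + x ≤ y) (sym (late b K≤a (ℕ.<⇒≤ a<) K<b))
          (sym (late-leave b (ℕ.m≤n⇒m≤1+n K≤a) a< K<b)) (V.order a b (ℕ.<-≤-trans K<b b≤a) a< b≤a)

-- Uncombing

setHeight-pair : ∀ {m} (k i : Fin (suc m)) (s : State (suc m)) → proj₁ (setHeight k i s) ≡ proj₁ s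
setHeight-pair zero    i s = refl
setHeight-pair (suc k) i s = refl

setHeight-here : ∀ {m} (k i : Fin (suc m)) {a} (s : State (suc m)) → a ≡ toℕ i →
  (0 < toℕ k → at (proj₂ s) a ≡ ht (proj₁ (proj₁ s)) a (ℕ.pred (toℕ k))) →
  at (proj₂ (setHeight k i s)) a ≡ ht (proj₁ (proj₁ s)) a (toℕ k)
setHeight-here zero    i (_ , h)       refl h≡ = at-≔ h i (+ toℕ i)
setHeight-here (suc k) i ((B , _) , h) refl h≡ = trans (at-≔ h i _)
  (cong₂ _-_ (trans (sym (at-! h i)) (h≡ (s≤s z≤n)))
    (trans (sym (ent-! B i (inject₁ k))) (cong (ent B (toℕ i)) (Fin.toℕ-inject₁ k))))

setHeight-other : ∀ {m} (k i : Fin (suc m)) {a} (s : State (suc m)) → a ≢ toℕ i →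
  at (proj₂ (setHeight k i s)) a ≡ at (proj₂ s) a
setHeight-other zero    i (_ , h) a≢i = at-≔-other h i _ a≢i
setHeight-other (suc k) i (_ , h) a≢i = at-≔-other h i _ a≢i

module Uncombing {m : ℕ} (k : Fin (suc m)) {BD₀ : Pair (suc m)}
                 (valid : Valid (toℕ k) BD₀) where
  private
    K : ℕ
    K = toℕ k
    B₀ = proj₁ BD₀
    D₀ = proj₂ BD₀
    module V = Valid valid

  -- Rows after t are final, rows before t are untouched, and row t is the
  -- intermediate path.
  record Stage (t : ℕ) (s : State (suc m)) : Set where
    private
      BD = proj₁ s
      B = proj₁ BD
      D = proj₂ BD
      h = proj₂ s
    field
      bits   : Bits B
      B-same : ∀ a b → a < t ⊎ K ℕ.≤ b → ent B a b ≡ ent B₀ a b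
      D-same : ∀ a b → a < t ⊎ b ≢ K → ent D a b ≡ ent D₀ a b
      exit   : ∀ a → ht B a K - ent D a K ≡ ht B₀ a K - ent D₀ a K
      D-zero : ∀ a → t < a → ent D a K ≡ 0ℤ
      upper  : ∀ a j → t ℕ.≤ a → suc a < suc m → j ℕ.≤ K → 1ℤ + ht B₀ a j ≤ ht B (suc a) j
      lower  : ∀ a j → t < a → j ℕ.≤ K → ht B a j ≤ ht B₀ a j
      mono   : ∀ j → j < K → ht B t j - ht B₀ t j ≤ ht B t (suc j) - ht B₀ t (suc j)
      h-done : ∀ a → t ℕ.≤ a → a < suc m → at h a ≡ ht B a K
      h-todo : ∀ a → K ℕ.≤ a → a < t → 0 < K → at h a ≡ ht B₀ a (ℕ.pred K)

    ht-earlier : ∀ {a} j → a < t → ht B a j ≡ ht B₀ a j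
    ht-earlier {a} j a<t = ht-cong B B₀ a j λ l _ → B-same a l (inj₁ a<t)

    lift-≥0 : ∀ j → j ℕ.≤ K → 0ℤ ≤ ht B t j - ht B₀ t j
    lift-≥0 zero    _   = ℤ.≤-reflexive (sym (ℤ.+-inverseʳ (+ t)))
    lift-≥0 (suc j) j<K = ℤ.≤-trans (lift-≥0 j (ℕ.<⇒≤ j<K)) (mono j j<K)

  ht-order : ∀ {a j} → K ℕ.≤ a → suc a < suc m → j ℕ.≤ K → 1ℤ + ht B₀ a j ≤ ht B₀ (suc a) j
  ht-order {a} {j} K≤a a< j≤K = ℤ.≤-trans (V.ht-order K≤a a< j≤K)
    (≤-from (V.D-nonneg (suc a) j) (eq (ht B₀ (suc a) j) (ent D₀ (suc a) j)))
    where eq : ∀ x y → x - (x - y) ≡ y - 0ℤ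
          eq = solve-∀

  first-stage : ∀ {s} → proj₁ s ≡ BD₀ →
                (∀ a → m ℕ.≤ a → a < suc m → at (proj₂ s) a ≡ ht B₀ a K) →
                (∀ a → K ℕ.≤ a → a < m → 0 < K → at (proj₂ s) a ≡ ht B₀ a (ℕ.pred K)) →
                Stage m s
  first-stage refl h-done h-todo = record
    { bits   = V.bits
    ; B-same = λ _ _ _ → refl
    ; D-same = λ _ _ _ → refl
    ; exit   = λ _ → refl
    ; D-zero = λ a m<a → ent-out D₀ m<a
    ; upper  = λ a j m≤a 1+a<1+m → ⊥-elim (ℕ.<⇒≱ (ℕ.≤-pred 1+a<1+m) m≤a)
    ; lower  = λ _ _ _ _ → ℤ.≤-refl
    ; mono   = λ j _ → ℤ.≤-reflexive
        (trans (ℤ.+-inverseʳ (ht B₀ m j)) (sym (ℤ.+-inverseʳ (ht B₀ m (suc j)))))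
    ; h-done = h-done
    ; h-todo = h-todo
    }

  module _ {i : Fin m} (K≤ι : K ℕ.≤ toℕ i) {BD : Pair (suc m)} {h h₁ : Vec ℤ (suc m)}
           (stage : Stage (suc (toℕ i)) (BD , h))
           (h-here : at h₁ (toℕ i) ≡ ht (proj₁ BD) (toℕ i) K)
           (h-else : ∀ a → a ≢ toℕ i → at h₁ a ≡ at h a) where
    private
      module S = Stage stage
      ι = toℕ i
      B = proj₁ BD
      D = proj₂ BD
      ι<m : suc ι < suc m
      ι<m = s≤s (Fin.toℕ<n i)

      ht-same : ∀ j → ht B ι j ≡ ht B₀ ι j
      ht-same j = S.ht-earlier j (ℕ.n<1+n ι)

      h-next : at h₁ (suc ι) ≡ ht B (suc ι) K
      h-next = trans (h-else (suc ι) (ℕ.>⇒≢ (ℕ.n<1+n ι))) (S.h-done (suc ι) ℕ.≤-refl ι<m)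

      d≤gap : ent D (suc ι) K ≤ gap B ι K
      d≤gap = ≤-from (subst₂ (λ x y → 1ℤ + x ≤ y) (sym (ht-same K)) (sym (S.exit (suc ι)))
                       (V.ht-order K≤ι ι<m ℕ.≤-refl))
                     (eq (ht B ι K) (ht B (suc ι) K) (ent D (suc ι) K))
        where eq : ∀ x y d → (y - x - 1ℤ) - d ≡ (y - d) - (1ℤ + x)
              eq = solve-∀

    cliffified : Cliffified i k (BD , h₁) (cliffify i k (BD , h₁))
    cliffified = cliffify-spec i k S.bits (cong₂ (λ x y → x - y - 1ℤ) h-next h-here) d≤gap

    module _ {s′} (c : Cliffified i k (BD , h₁) s′) where
      private
        module C = Cliffified c

      lift≤ν : ∀ j → j ℕ.≤ K → ht B (suc ι) j - ht B₀ (suc ι) j ≤ C.ν j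
      lift≤ν = min-greatest C.ν-min (λ j → ht B (suc ι) j - ht B₀ (suc ι) j)
        (≤-from (V.D-nonneg (suc ι) K)
          (trans (eq (ht B (suc ι) K) (ent D (suc ι) K) (ht B₀ (suc ι) K))
          (trans (cong (λ z → ht B₀ (suc ι) K - z) (S.exit (suc ι)))
                 (eq′ (ht B₀ (suc ι) K) (ent D₀ (suc ι) K)))))
        S.mono
        λ j j≤K → ≤-from
          (subst (λ z → 1ℤ + z ≤ ht B₀ (suc ι) j) (sym (ht-same j)) (ht-order K≤ι ι<m j≤K))
                         (eq″ (ht B (suc ι) j) (ht B ι j) (ht B₀ (suc ι) j))
        where
        eq : ∀ x d y → d - (x - y) ≡ y - (x - d)
        eq = solve-∀
        eq′ : ∀ y d → y - (y - d) ≡ d - 0ℤ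
        eq′ = solve-∀
        eq″ : ∀ y x z → (y - x - 1ℤ) - (y - z) ≡ z - (1ℤ + x)
        eq″ = solve-∀

      ν₀ : C.ν 0 ≡ 0ℤ
      ν₀ = ℤ.≤-antisym
        (ℤ.≤-trans (RunningMin.below C.ν-min 0 z≤n) (ℤ.≤-reflexive (gap-0 B ι)))
        (ℤ.≤-trans (S.lift-≥0 0 z≤n) (lift≤ν 0 z≤n))

      open Inversion.Cliffified-ht i k c ν₀
      open Shifted shifted using (other)

      next-stage : Stage ι s′
      next-stage = record
        { bits   = bits
        ; B-same = λ { a b (inj₁ a<ι) → trans (other a b (inj₁ (apart a<ι)))
                                          (S.B-same a b (inj₁ (ℕ.m<n⇒m<1+n a<ι)))
                     ; a b (inj₂ K≤b) → trans (other a b (inj₂ (ℕ.≤⇒≯ K≤b)))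
                                          (S.B-same a b (inj₂ K≤b)) }
        ; D-same = λ { a b (inj₁ a<ι) → trans (D-other (inj₁ (apart a<ι)))
                                          (S.D-same a b (inj₁ (ℕ.m<n⇒m<1+n a<ι)))
                     ; a b (inj₂ b≢K) → trans (D-other (inj₂ b≢K)) (S.D-same a b (inj₂ b≢K)) }
        ; exit   = exit′
        ; D-zero = D-zero′
        ; upper  = upper′
        ; lower  = lower′
        ; mono   = λ j j<K → subst₂ _≤_ (ν≡ j (ℕ.<⇒≤ j<K)) (ν≡ (suc j) j<K) (mono j j<K)
        ; h-done = h-done′
        ; h-todo = λ a K≤a a<ι 0<K → let (p , q) = apart a<ι in
            trans (h-other p q) (trans (h-else a p) (S.h-todo a K≤a (ℕ.m<n⇒m<1+n a<ι) 0<K))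
        }
        where
        B′ = proj₁ (proj₁ s′)
        D′ = proj₂ (proj₁ s′)
        h′ = proj₂ s′

        apart : ∀ {a} → a < ι → a ≢ ι × a ≢ suc ι
        apart a<ι = ℕ.<⇒≢ a<ι , ℕ.<⇒≢ (ℕ.m<n⇒m<1+n a<ι)

        other-ht : ∀ {a} → a ≢ ι → a ≢ suc ι → ∀ j → ht B′ a j ≡ ht B a j
        other-ht = shifted-ht-other shifted

        ν≡ : ∀ j → j ℕ.≤ K → ν j ≡ ht B′ ι j - ht B₀ ι j
        ν≡ j j≤K = trans (eq (ht B ι j) (ν j)) (cong₂ _-_ (sym (ht-upper j j≤K)) (ht-same j))
          where eq : ∀ x y → y ≡ (x + y) - x
                eq = solve-∀

        exit′ : ∀ a → ht B′ a K - ent D′ a K ≡ ht B₀ a K - ent D₀ a K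
        exit′ a with a ℕ.≟ ι | a ℕ.≟ suc ι
        ... | yes refl | _ = trans (cong₂ _-_ (trans (ht-upper K ℕ.≤-refl)
              (cong (λ z → ht B a K + z) start)) D-upper)
              (trans (eq (ht B a K) (ent D (suc a) K) (ent D a K)) (S.exit a))
          where eq : ∀ x d e → (x + d) - (e + d) ≡ x - e
                eq = solve-∀
        ... | no _ | yes refl = trans (cong₂ _-_ (trans (ht-lower K ℕ.≤-refl)
              (cong (λ z → ht B a K - z) start)) D-lower)
              (trans (ℤ.+-identityʳ _) (S.exit a))
        ... | no p | no q = trans (cong₂ _-_ (other-ht p q K) (D-other (inj₁ (p , q)))) (S.exit a)

        D-zero′ : ∀ a → ι < a → ent D′ a K ≡ 0ℤ
        D-zero′ a ι<a with a ℕ.≟ suc ι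
        ... | yes refl = D-lower
        ... | no q     = trans (D-other (inj₁ (ℕ.>⇒≢ ι<a , q))) (S.D-zero a (ℕ.≤∧≢⇒< ι<a (q ∘ sym)))

        upper′ : ∀ a j → ι ℕ.≤ a → suc a < suc m → j ℕ.≤ K → 1ℤ + ht B₀ a j ≤ ht B′ (suc a) j
        upper′ a j ι≤a a< j≤K with ℕ.m≤n⇒m<n∨m≡n ι≤a
        ... | inj₁ ι<a  = subst (1ℤ + ht B₀ a j ≤_)
              (sym (other-ht (ℕ.>⇒≢ (ℕ.m<n⇒m<1+n ι<a)) (ℕ.>⇒≢ (s≤s ι<a)) j)) (S.upper a j ι<a a< j≤K)
        ... | inj₂ refl = subst₂ (λ x y → 1ℤ + x ≤ y) (ht-same j) (sym (ht-lower j j≤K))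
              (≤-from (below j j≤K) (eq (ht B (suc a) j) (ht B a j) (ν j)))
          where eq : ∀ y x v → (y - v) - (1ℤ + x) ≡ (y - x - 1ℤ) - v
                eq = solve-∀

        lower′ : ∀ a j → ι < a → j ℕ.≤ K → ht B′ a j ≤ ht B₀ a j
        lower′ a j ι<a j≤K with a ℕ.≟ suc ι
        ... | yes refl = subst (_≤ ht B₀ a j) (sym (ht-lower j j≤K))
              (≤-from (lift≤ν j j≤K) (eq (ht B a j) (ht B₀ a j) (ν j)))
          where eq : ∀ y x v → x - (y - v) ≡ v - (y - x)
                eq = solve-∀
        ... | no q     = subst (_≤ ht B₀ a j) (sym (other-ht (ℕ.>⇒≢ ι<a) q j))
              (S.lower a j (ℕ.≤∧≢⇒< ι<a (q ∘ sym)) j≤K)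

        h-done′ : ∀ a → ι ℕ.≤ a → a < suc m → at h′ a ≡ ht B′ a K
        h-done′ a ι≤a a<n with a ℕ.≟ ι | a ℕ.≟ suc ι
        ... | yes refl | _        = 
              trans h-upper (trans (cong₂ _+_ h-here (sym start)) (sym (ht-upper K ℕ.≤-refl)))
        ... | no _     | yes refl = 
              trans h-lower (trans (cong₂ _-_ h-next (sym start)) (sym (ht-lower K ℕ.≤-refl)))
        ... | no p     | no q     = trans (h-other p q) (trans (h-else a p)
              (trans (S.h-done a (ℕ.≤∧≢⇒< ι≤a (p ∘ sym)) a<n) (sym (other-ht p q K))))

  last-stage : ∀ {s} → Stage K s → Valid (suc K) (proj₁ s)
  last-stage {s} stage = record
    { bits     = bits
    ; B-lower  = B-lower
    ; D-nonneg = D-nonneg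
    ; D-lower  = λ a b a<b → trans (D-same a b (case-< a<b)) (V.D-lower a b a<b)
    ; ends     = ends
    ; early    = early
    ; order    = order
    }
    where
    open Stage stage
    BD = proj₁ s
    B = proj₁ BD
    D = proj₂ BD

    case-< : ∀ {a b} → a < b → a < K ⊎ b ≢ K
    case-< {a} {b} a<b with b ℕ.≟ K
    ... | yes refl = inj₁ a<b
    ... | no b≢K   = inj₂ b≢K

    B-lower : ∀ a b → a ℕ.≤ b → ent B a b ≡ 0ℤ
    B-lower a b a≤b with a ℕ.<? K
    ... | yes a<K = trans (B-same a b (inj₁ a<K)) (V.B-lower a b a≤b)
    ... | no a≮K  = trans (B-same a b (inj₂ (ℕ.≤-trans (ℕ.≮⇒≥ a≮K) a≤b))) (V.B-lower a b a≤b)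

    early : ∀ a b → b < suc K → b < a → ent D a b ≡ 0ℤ
    early a b b≤K b<a with b ℕ.≟ K
    ... | yes refl = D-zero a b<a
    ... | no b≢K   = trans (D-same a b (inj₂ b≢K)) (V.early a b (ℕ.≤∧≢⇒< (ℕ.≤-pred b≤K) b≢K) b<a)

    enter≡ht : ∀ {a} j → j ℕ.≤ K → K ℕ.≤ a → enter BD a j ≡ ht B a j
    enter≡ht {a} j j≤K K≤a = enter-early BD a j λ b b<j →
      early a b (ℕ.m<n⇒m<1+n (ℕ.<-≤-trans b<j j≤K)) (ℕ.<-≤-trans (ℕ.<-≤-trans b<j j≤K) K≤a)

    D-nonneg : ∀ a b → 0ℤ ≤ ent D a b
    D-nonneg a b with ℕ.<-cmp a K | b ℕ.≟ K
    ... | _             | no b≢K   = subst (0ℤ ≤_) (sym (D-same a b (inj₂ b≢K))) (V.D-nonneg a b)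
    ... | tri< a<K _ _  | yes _    = subst (0ℤ ≤_) (sym (D-same a b (inj₁ a<K))) (V.D-nonneg a b)
    ... | tri> _ _ K<a  | yes refl = ℤ.≤-reflexive (sym (D-zero a K<a))
    ... | tri≈ _ refl _ | yes refl = ≤-from (ℤ.+-mono-≤ (lift-≥0 b ℕ.≤-refl) (V.D-nonneg b b))
          (trans (eq (ht B b b) (ent D b b) (ht B₀ b b) (ent D₀ b b))
          (trans (cong (λ z → (ht B b b - ht B₀ b b) + ent D₀ b b - z)
                   (trans (cong (_- (ht B₀ b b - ent D₀ b b)) (exit b))
                          (ℤ.+-inverseʳ (ht B₀ b b - ent D₀ b b)))) refl))
      where eq : ∀ y d x e → d - 0ℤ ≡ (y - x) + e - ((y - d) - (x - e))
            eq = solve-∀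

    leave-K : ∀ {a} → K ℕ.≤ a → leave BD a K ≡ leave BD₀ a K
    leave-K {a} K≤a = trans (cong (_- ent D a K) (enter≡ht K ℕ.≤-refl K≤a))
      (trans (exit a) (cong (_- ent D₀ a K) (sym (V.enter≡ht ℕ.≤-refl K≤a))))

    late : ∀ {a} j → K ℕ.≤ a → K < j → enter BD a j ≡ enter BD₀ a j
    late {a} j K≤a = enter-late BD BD₀ j (λ b K≤b → B-same a b (inj₂ K≤b))
      (λ b K<b → D-same a b (inj₂ (ℕ.>⇒≢ K<b))) (leave-K K≤a)

    late-leave : ∀ {a} j → K ℕ.≤ a → K < j → leave BD a j ≡ leave BD₀ a j
    late-leave {a} j K≤a K<j = cong₂ _-_ (late j K≤a K<j) (D-same a j (inj₂ (ℕ.>⇒≢ K<j)))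

    ends : ∀ a → a < suc m → leave BD a a ≡ 0ℤ
    ends a a<n with ℕ.<-cmp a K
    ... | tri< a<K _ _  = trans (cong₂ _-_
          (enter-cong BD BD₀ a (λ b → B-same a b (inj₁ a<K)) (λ b → D-same a b (inj₁ a<K)))
          (D-same a a (inj₁ a<K))) (V.ends a a<n)
    ... | tri≈ _ refl _ = trans (leave-K ℕ.≤-refl) (V.ends a a<n)
    ... | tri> _ _ K<a  = trans (late-leave a (ℕ.<⇒≤ K<a) K<a) (V.ends a a<n)

    order : ∀ a b → suc K ℕ.≤ a → suc a < suc m → b ℕ.≤ a → 1ℤ + enter BD a b ≤ leave BD (suc a) b
    order a b K<a a< b≤a with b ℕ.≤? K
    ... | yes b≤K = subst₂ (λ x y → 1ℤ + x ≤ y) (sym (enter≡ht b b≤K K≤a))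
          (sym (trans (minus-0 _ (early (suc a) b (s≤s b≤K) (s≤s b≤a)))
                      (enter≡ht b b≤K (ℕ.m≤n⇒m≤1+n K≤a))))
          (ℤ.≤-trans (ℤ.+-monoʳ-≤ 1ℤ (lower a b K<a b≤K)) (upper a b K≤a a< b≤K))
      where K≤a = ℕ.<⇒≤ K<a
    ... | no b≰K  = subst₂ (λ x y → 1ℤ + x ≤ y) (sym (late b K≤a K<b))
          (sym (late-leave b (ℕ.m≤n⇒m≤1+n K≤a) K<b)) (V.order a b K≤a a< b≤a)
      where
      K<b = ℕ.≰⇒> b≰K
      K≤a = ℕ.<⇒≤ K<a

-- Paths

private variable
  x y z : Point

column-mono : Path x y → proj₂ x ≤ proj₂ y
column-mono ε                                  = ℤ.≤-refl
column-mono {x = r , c} ((horizontal , refl) ◅ π) = ℤ.≤-trans (ℤ.i≤i+j c 1ℤ) (column-mono π)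
column-mono {x = r , c} ((diagonal , refl) ◅ π)   = ℤ.≤-trans (ℤ.i≤i+j c 1ℤ) (column-mono π)
column-mono {x = r , c} ((vertical , refl) ◅ π)   = column-mono π

step : (x : Point) (δ : Direction) → y ≡ move δ x → Path y z → Path x z
step x δ e π = (δ , e) ◅ π

private
  isVertical : (c : ℤ) → _
  isVertical c = ≡-dec _≟ᴰ_ ℤ._≟_ (vertical , c)

verticalSteps-≢ : ∀ c x δ (e : y ≡ move δ x) (π : Path y z) → (vertical , c) ≢ (δ , proj₂ x) →
                  verticalSteps c (step x δ e π) ≡ verticalSteps c π
verticalSteps-≢ c x δ e π ne = cong length (List.filter-reject (isVertical c) ne)

verticalSteps-≡ : ∀ c x (e : y ≡ move vertical x) (π : Path y z) → c ≡ proj₂ x →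
                  verticalSteps c (step x vertical e π) ≡ suc (verticalSteps c π)
verticalSteps-≡ c x e π refl = cong length (List.filter-accept (isVertical c) refl)

verticalSteps-before : ∀ {c} (π : Path x y) → c ℤ.< proj₂ x → verticalSteps c π ≡ 0
verticalSteps-before ε _ = refl
verticalSteps-before {x = x@(_ , c′)} {c = c} ((horizontal , refl) ◅ π) c<c′ =
  trans (verticalSteps-≢ c x horizontal refl π λ ())
        (verticalSteps-before π (ℤ.<-≤-trans c<c′ (ℤ.i≤i+j c′ 1ℤ)))
verticalSteps-before {x = x@(_ , c′)} {c = c} ((diagonal , refl) ◅ π) c<c′ =
  trans (verticalSteps-≢ c x diagonal refl π λ ())
        (verticalSteps-before π (ℤ.<-≤-trans c<c′ (ℤ.i≤i+j c′ 1ℤ)))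
verticalSteps-before {x = x} {c = c} ((vertical , refl) ◅ π) c<c′ =
  trans (verticalSteps-≢ c x vertical refl π λ { refl → ℤ.<-irrefl refl c<c′ })
        (verticalSteps-before π c<c′)

-- b and f stand for the row of B and for the heights at which the path leaves
-- the columns; f l - b l is then the height at which it enters column l + 1.
module Trace (i : ℕ) (b f : ℕ → ℤ) where

  record Follows {x y} (j : ℕ) (π : Path x y) : Set where
    field
      hor   : ∀ l → l < i → (horizontal , + l) ∈ steps π → b l ≡ 0ℤ
      diag  : ∀ l → l < i → (diagonal , + l) ∈ steps π → b l ≡ 1ℤ
      first : f j ≡ proj₁ x - + verticalSteps (+ j) π
      later : ∀ l → j ℕ.≤ l → l < i → f (suc l) ≡ f l - b l - + verticalSteps (+ suc l) π

  Traced : ∀ {x y} → ℕ → Path x y → Set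
  Traced {x} j π =
    f i ≡ 0ℤ × (∀ r → f j ≤ r → r ≤ proj₁ x → (r , + j) ∈ support π) ×
    (∀ l r → j ℕ.≤ l → l < i → f (suc l) ≤ r → r ≤ f l - b l → (r , + suc l) ∈ support π)

  sideways-< : ∀ {x j y} → y ≡ (0ℤ , + i) → proj₂ x ≡ + suc j → Path x y → j < i
  sideways-< y≡ e π = ℤ.drop‿+≤+ (subst₂ _≤_ e (cong proj₂ y≡) (column-mono π))

  traced-sideways : ∀ {r j δ y} (π : Path (move δ (r , + j)) y) → y ≡ (0ℤ , + i) →
                    δ ≢ vertical → proj₂ (move δ (r , + j)) ≡ + suc j →
                    proj₁ (move δ (r , + j)) ≡ r - b j → Follows j (step (r , + j) δ refl π) →
                    (Follows (suc j) π → Traced (suc j) π) → Traced j (step (r , + j) δ refl π)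
  traced-sideways {r} {j} {δ} π y≡ ne col row F traced =
      end
    , (λ r′ lo hi → here (cong (_, + j) (ℤ.≤-antisym hi (subst (_≤ r′) f≡ lo))))
    , λ l r′ j≤l l<i lo hi → there ([ (λ j<l → next l r′ j<l l<i lo hi)
        , (λ { refl → now r′ lo (subst (r′ ≤_) (trans (cong (_- b l) f≡) (sym row)) hi) }) ]′
        (ℕ.m≤n⇒m<n∨m≡n j≤l))
    where
    open Follows F
    same : ∀ c → verticalSteps c (step (r , + j) δ refl π) ≡ verticalSteps c π
    same c = verticalSteps-≢ c (r , + j) δ refl π λ e → ne (sym (cong proj₁ e))
    f≡ : f j ≡ r
    f≡ = trans first (trans (cong (λ v → r - + v) (trans (same (+ j))
           (verticalSteps-before π (subst (+ j ℤ.<_) (sym col) (+<+ (ℕ.n<1+n j))))))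
           (ℤ.+-identityʳ r))
    tail : Traced (suc j) π
    tail = traced record
      { hor   = λ l l<i e → hor l l<i (there e)
      ; diag  = λ l l<i e → diag l l<i (there e)
      ; first = trans (later j ℕ.≤-refl (sideways-< y≡ col π))
          (cong₂ (λ u v → u - + v) (trans (cong (_- b j) f≡) (sym row)) (same (+ suc j)))
      ; later = λ l j<l l<i → trans (later l (ℕ.<⇒≤ j<l) l<i)
          (cong (λ v → f l - b l - + v) (same (+ suc l)))
      }
    end  = proj₁ tail
    now  = proj₁ (proj₂ tail)
    next = proj₂ (proj₂ tail)

  +1≡suc : ∀ j → + j + 1ℤ ≡ + suc j
  +1≡suc j = cong +_ (ℕ.+-comm j 1)

  trace : ∀ {x y j} (π : Path x y) → y ≡ (0ℤ , + i) → proj₂ x ≡ + j → Follows j π → Traced j π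
  trace {j = j} ε refl refl F =
      first
    , (λ r lo hi → here (cong (_, + j) (ℤ.≤-antisym hi (subst (_≤ r) first lo))))
    , λ l r j≤l l<i → ⊥-elim (ℕ.<⇒≱ l<i j≤l)
    where open Follows F
  trace {r , _} {j = j} ((horizontal , refl) ◅ π) y≡ refl F =
    traced-sideways π y≡ (λ ()) (+1≡suc j)
      (sym (trans (cong (λ v → r - v) (Follows.hor F j (sideways-< y≡ (+1≡suc j) π) (here refl)))
                  (ℤ.+-identityʳ r)))
      F (trace π y≡ (+1≡suc j))
  trace {r , _} {j = j} ((diagonal , refl) ◅ π) y≡ refl F =
    traced-sideways π y≡ (λ ()) (+1≡suc j)
      (sym (cong (λ v → r - v) (Follows.diag F j (sideways-< y≡ (+1≡suc j) π) (here refl))))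
      F (trace π y≡ (+1≡suc j))
  trace {r , _} {j = j} ((vertical , refl) ◅ π) y≡ refl F with trace π y≡ refl F′
    where
    open Follows F
    eq : ∀ r v → r - (1ℤ + v) ≡ r + -1ℤ - v
    eq = solve-∀
    F′ : Follows j π
    F′ = record
      { hor   = λ l l<i e → hor l l<i (there e)
      ; diag  = λ l l<i e → diag l l<i (there e)
      ; first = trans first (trans (cong (λ v → r - + v) (verticalSteps-≡ (+ j) (r , + j) refl π refl))
                                   (eq r (+ verticalSteps (+ j) π)))
      ; later = λ l j≤l l<i → trans (later l j≤l l<i) (cong (λ v → f l - b l - + v)
          (verticalSteps-≢ (+ suc l) (r , + j) vertical refl π λ { refl → ℕ.<⇒≱ (ℕ.n<1+n l) j≤l }))
      }
  ... | end , now , next =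
      end
    , (λ r′ lo hi → [ (λ r′<r → there (now r′ lo (r′≤ r′<r))) , (λ r′≡r → here (cong (_, + j) r′≡r)) ]′
          (split r′ hi))
    , λ l r′ j≤l l<i lo hi → there (next l r′ j≤l l<i lo hi)
    where
    r′≤ : ∀ {r′} → r′ ℤ.< r → r′ ≤ r + -1ℤ
    r′≤ {r′} lt = ≤-from (ℤ.i<j⇒suc[i]≤j lt) (eq r r′)
      where eq : ∀ r s → r + -1ℤ - s ≡ r - (1ℤ + s)
            eq = solve-∀
    split : ∀ r′ → r′ ≤ r → r′ ℤ.< r ⊎ r′ ≡ r
    split r′ hi with r′ ℤ.≟ r
    ... | yes e = inj₂ e
    ... | no ne = inj₁ (ℤ.≤∧≢⇒< hi ne)

  Built : Point → ℕ → Set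
  Built x j = Σ[ π ∈ Path x (0ℤ , + i) ] Follows j π ×
    (∀ {q} → q ∈ support π →
      (proj₂ q ≡ + j × f j ≤ proj₁ q × proj₁ q ≤ proj₁ x) ⊎
      (Σ[ l ∈ ℕ ] j ℕ.≤ l × l < i × proj₂ q ≡ + suc l × f (suc l) ≤ proj₁ q × proj₁ q ≤ f l - b l))

  build-ε : f i ≡ 0ℤ → ∀ {r} → r ≡ 0ℤ → Built (r , + i) i
  build-ε f≡ refl = ε
    , record { hor = λ _ _ () ; diag = λ _ _ () ; first = f≡
             ; later = λ l i≤l l<i → ⊥-elim (ℕ.<⇒≱ l<i i≤l) }
    , λ { (here refl) → inj₁ (refl , ℤ.≤-reflexive f≡ , ℤ.≤-refl) }

  build-sideways : ∀ {j} δ → (δ ≡ horizontal → b j ≡ 0ℤ) → (δ ≡ diagonal → b j ≡ 1ℤ) →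
                   δ ≢ vertical → (f j - b j , + suc j) ≡ move δ (f j , + j) → j < i →
                   Built (f j - b j , + suc j) (suc j) → Built (f j , + j) j
  build-sideways {j} δ b-hor b-diag ne e j<i (π , F , within) =
      step (f j , + j) δ e π
    , record
      { hor   = λ { l l<i (here refl) → b-hor refl ; l l<i (there p) → hor l l<i p }
      ; diag  = λ { l l<i (here refl) → b-diag refl ; l l<i (there p) → diag l l<i p }
      ; first = sym (trans (cong (λ v → f j - + v) (trans (same (+ j))
                  (verticalSteps-before π (+<+ (ℕ.n<1+n j))))) (ℤ.+-identityʳ (f j)))
      ; later = λ l j≤l l<i → trans (later′ l (ℕ.m≤n⇒m<n∨m≡n j≤l) l<i)
                  (cong (λ v → f l - b l - + v) (sym (same (+ suc l))))
      }
    , λ { (here refl) → inj₁ (refl , ℤ.≤-refl , ℤ.≤-refl)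
        ; (there p) → inj₂ ([ (λ (c , lo , hi) → j , ℕ.≤-refl , j<i , c , lo , hi)
                            , (λ (l , j<l , rest) → l , ℕ.<⇒≤ j<l , rest) ]′ (within p)) }
    where
    open Follows F
    same : ∀ c → verticalSteps c (step (f j , + j) δ e π) ≡ verticalSteps c π
    same c = verticalSteps-≢ c (f j , + j) δ e π λ e → ne (sym (cong proj₁ e))
    later′ : ∀ l → j < l ⊎ j ≡ l → l < i → f (suc l) ≡ f l - b l - + verticalSteps (+ suc l) π
    later′ l (inj₁ j<l)  = later l j<l
    later′ l (inj₂ refl) = λ _ → first

  build-vertical : ∀ {j} v {r} → r ≡ f j + + v → Built (f j , + j) j → Built (r , + j) j
  build-vertical {j} zero e base =
    subst (λ r → Built (r , + j) j) (sym (trans e (ℤ.+-identityʳ (f j)))) base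
  build-vertical {j} (suc v) {r} e base = extend (build-vertical v e′ base)
    where
    eq : ∀ x v → x + (1ℤ + v) + -1ℤ ≡ x + v
    eq = solve-∀
    eq′ : ∀ r v → r + -1ℤ - v ≡ r - (1ℤ + v)
    eq′ = solve-∀
    e′ : r + -1ℤ ≡ f j + + v
    e′ = trans (cong (_+ -1ℤ) e) (eq (f j) (+ v))
    f≤r : f j ≤ r
    f≤r = subst (f j ≤_) (sym e) (ℤ.i≤i+j (f j) (+ suc v))
    extend : Built (r + -1ℤ , + j) j → Built (r , + j) j
    extend (π , F , within) =
        step (r , + j) vertical refl π
      , record
        { hor   = λ { l l<i (here ()) ; l l<i (there p) → hor l l<i p }
        ; diag  = λ { l l<i (here ()) ; l l<i (there p) → diag l l<i p }
        ; first = trans first (trans (eq′ r (+ verticalSteps (+ j) π))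
            (cong (λ v → r - + v) (sym (verticalSteps-≡ (+ j) (r , + j) refl π refl))))
        ; later = λ l j≤l l<i → trans (later l j≤l l<i) (cong (λ v → f l - b l - + v)
            (sym (verticalSteps-≢ (+ suc l) (r , + j) vertical refl π
                    λ { refl → ℕ.<⇒≱ (ℕ.n<1+n l) j≤l })))
        }
      , λ { (here refl) → inj₁ (refl , f≤r , ℤ.≤-refl)
          ; (there p) → [ (λ (c , lo , hi) → inj₁ (c , lo , ℤ.≤-trans hi (ℤ.i-j≤i r 1ℤ)))
                        , inj₂ ]′ (within p) }
      where open Follows F

  build : (∀ l → Bit (b l)) → (∀ l → f (suc l) ≤ f l - b l) → f i ≡ 0ℤ →
          ∀ t j {r} → j ℕ.+ t ≡ i → f j ≤ r → Built (r , + j) j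
  build bits drops end t j {r} j+t≡i f≤r = build-vertical ∣ r - f j ∣ r≡ (flat t j+t≡i)
    where
    eq : ∀ r x → r ≡ x + (r - x)
    eq = solve-∀
    r≡ : r ≡ f j + + ∣ r - f j ∣
    r≡ = trans (eq r (f j)) (cong (λ v → f j + v) (sym (ℤ.0≤i⇒+∣i∣≡i (ℤ.i≤j⇒0≤j-i f≤r))))
    flat : ∀ t → j ℕ.+ t ≡ i → Built (f j , + j) j
    flat zero    e with trans (sym (ℕ.+-identityʳ j)) e
    ... | refl = build-ε end end
    flat (suc t) e = [ (λ b≡0 → build-sideways horizontal (λ _ → b≡0) (λ ()) (λ ())
                         (cong₂ _,_ (trans (cong (λ v → f j - v) b≡0) (ℤ.+-identityʳ (f j)))
                                    (sym (+1≡suc j)))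
                         j<i rest)
                     , (λ b≡1 → build-sideways diagonal (λ ()) (λ _ → b≡1) (λ ())
                         (cong₂ _,_ (cong (λ v → f j - v) b≡1) (sym (+1≡suc j))) j<i rest) ]′ (bits j)
      where
      e′ = trans (sym (ℕ.+-suc j t)) e
      j<i : j < i
      j<i = subst (suc j ℕ.≤_) e′ (ℕ.m≤m+n (suc j) t)
      rest = build bits drops end t (suc j) e′ (drops j)

private variable
  k : ℕ

minus-injective : ∀ x {y z} → x - y ≡ x - z → y ≡ z
minus-injective x {y} {z} e = trans (eq x y) (trans (cong (λ v → x - v) e) (sym (eq x z)))
  where eq : ∀ x y → y ≡ x - (x - y)
        eq = solve-∀

fin : {l : ℕ} → l < n → Σ[ j ∈ Fin n ] toℕ j ≡ l
fin l<n = fromℕ< l<n , Fin.toℕ-fromℕ< l<n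

leave≤enter : (BD : Pair n) → (∀ a b → 0ℤ ≤ ent (proj₂ BD) a b) →
              ∀ a j → leave BD a j ≤ enter BD a j
leave≤enter BD D-nonneg a j = ≤-from (D-nonneg a j) (eq (enter BD a j) (ent (proj₂ BD) a j))
  where eq : ∀ x d → x - (x - d) ≡ d - 0ℤ
        eq = solve-∀

module FromPaths {BD : Pair n} (elt : IsPathfamAt k BD) where
  open IsPathfamAt elt
  open IsPathfam isPathfam
  open Encodes encodes
  private
    B = proj₁ BD
    D = proj₂ BD

  D-nonneg : ∀ a b → 0ℤ ≤ ent D a b
  D-nonneg = ent-all (λ _ _ → 0ℤ ≤_) D (λ _ _ → ℤ.≤-refl) D-entries

  bits : Bits B
  bits = ent-all (λ _ _ → Bit) B (λ _ _ → inj₁ refl) B-entries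

  module _ (i : Fin n) where
    private
      a = toℕ i
    open Trace a (ent B a) (leave BD a)

    column : ∀ {l} → l ℕ.≤ a → Σ[ j ∈ Fin n ] toℕ j ≡ l
    column l≤a = fin (ℕ.≤-<-trans l≤a (Fin.toℕ<n i))

    drop : ∀ l → l ℕ.≤ a → ent D a l ≡ + verticalSteps (+ l) (family i)
    drop l l≤a with column l≤a
    ... | j , refl = trans (ent-! D i j) (verticals i j l≤a)

    follows : Follows 0 (family i)
    follows = record
      { hor   = λ l l<a → hor l l<a (column (ℕ.<⇒≤ l<a))
      ; diag  = λ l l<a → diag l l<a (column (ℕ.<⇒≤ l<a))
      ; first = cong (λ v → + a - v) (drop 0 z≤n)
      ; later = λ l _ l<a → cong (λ v → leave BD a l - ent B a l - v) (drop (suc l) l<a)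
      }
      where
      hor : ∀ l → l < a → Σ[ j ∈ Fin n ] toℕ j ≡ l →
            (horizontal , + l) ∈ steps (family i) → ent B a l ≡ 0ℤ
      hor l l<a (j , refl) p = trans (ent-! B i j) (horizontal⇒0 i j l<a p)
      diag : ∀ l → l < a → Σ[ j ∈ Fin n ] toℕ j ≡ l →
             (diagonal , + l) ∈ steps (family i) → ent B a l ≡ 1ℤ
      diag l l<a (j , refl) p = trans (ent-! B i j) (diagonal⇒1 i j l<a p)

    traced : Traced 0 (family i)
    traced = trace (family i) refl refl follows

    reached : ∀ l {r} → l ℕ.≤ a → leave BD a l ≤ r → r ≤ enter BD a l → (r , + l) ∈ support (family i)
    reached zero    _   lo hi = proj₁ (proj₂ traced) _ lo hi
    reached (suc l) l<a lo hi = proj₂ (proj₂ traced) l _ z≤n l<a lo hi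

  order : ∀ (i i′ : Fin n) → toℕ i′ ≡ suc (toℕ i) → k ℕ.≤ toℕ i → ∀ b → b ℕ.≤ toℕ i →
          1ℤ + enter BD (toℕ i) b ≤ leave BD (suc (toℕ i)) b
  order i i′ i′≡ k≤a = above
    where
    a = toℕ i
    i≢i′ : i ≢ i′
    i≢i′ refl = ℕ.<-irrefl i′≡ (ℕ.n<1+n a)

    apart : ∀ b → b ℕ.≤ a → enter BD a b ≤ enter BD (suc a) b →
            1ℤ + enter BD a b ≤ leave BD (suc a) b
    apart b b≤a e≤e with enter BD a b ℤ.<? leave BD (suc a) b
    ... | yes lt = ℤ.i<j⇒suc[i]≤j lt
    ... | no ¬lt = ⊥-elim (disjoint i i′ k≤a (subst (k ℕ.≤_) (sym i′≡) (ℕ.m≤n⇒m≤1+n k≤a)) i≢i′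
            ( reached i b b≤a (leave≤enter BD D-nonneg a b) ℤ.≤-refl
            , reached i′ b (subst (b ℕ.≤_) (sym i′≡) (ℕ.m≤n⇒m≤1+n b≤a))
                (subst (λ z → leave BD z b ≤ enter BD a b) (sym i′≡) (ℤ.≮⇒≥ ¬lt))
                (subst (λ z → enter BD a b ≤ enter BD z b) (sym i′≡) e≤e)))

    above : ∀ b → b ℕ.≤ a → 1ℤ + enter BD a b ≤ leave BD (suc a) b
    above zero    b≤a = apart 0 b≤a (+≤+ (ℕ.n≤1+n a))
    above (suc b) b<a = apart (suc b) b<a (≤-from
      (ℤ.+-mono-≤ (ℤ.+-mono-≤ (above b (ℕ.<⇒≤ b<a)) (D-nonneg a b))
                  (ℤ.+-mono-≤ (bit≤1 (bits (suc a) b)) (0≤bit (bits a b))))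
      (eq (enter BD a b) (ent D a b) (ent B a b) (leave BD (suc a) b) (ent B (suc a) b)))
      where eq : ∀ e d x l y → (l - y) - (e - d - x) ≡
                                 ((l + d) + (1ℤ + x)) - (((1ℤ + e) + 0ℤ) + (y + 0ℤ))
            eq = solve-∀

  valid : Valid k BD
  valid = record
    { bits     = bits
    ; B-lower  = ent-all (λ a b x → a ℕ.≤ b → x ≡ 0ℤ) B (λ _ _ _ → refl) B-triangular
    ; D-nonneg = D-nonneg
    ; D-lower  = ent-all (λ a b x → a < b → x ≡ 0ℤ) D (λ _ _ _ → refl) D-triangular
    ; ends     = λ a a<n → let (i , e) = fin a<n in
        subst (λ a → leave BD a a ≡ 0ℤ) e (proj₁ (traced i))
    ; early    = ent-all (λ a b x → b < k → b < a → x ≡ 0ℤ) D (λ _ _ _ _ → refl) noEarlyVertical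
    ; order    = λ a b k≤a a< b≤a → order′ a b k≤a b≤a (fin (ℕ.<⇒≤ a<)) (fin a<)
    }
    where
    order′ : ∀ a b → k ℕ.≤ a → b ℕ.≤ a → Σ[ i ∈ Fin n ] toℕ i ≡ a → Σ[ i ∈ Fin n ] toℕ i ≡ suc a →
             1ℤ + enter BD a b ≤ leave BD (suc a) b
    order′ a b k≤a b≤a (i , refl) (i′ , e) = order i i′ e k≤a b b≤a

module ToPaths {BD : Pair n} (valid : Valid k BD) where
  open Valid valid
  private
    B = proj₁ BD
    D = proj₂ BD

  module _ (i : Fin n) where
    private
      a = toℕ i
    open Trace a (ent B a) (leave BD a)

    built : Built (+ a , 0ℤ) 0
    built = build (bits a) drops (ends a (Fin.toℕ<n i)) a 0 refl (drop (+ a) 0)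
      where
      drop : ∀ x j → x - ent D a j ≤ x
      drop x j = ≤-from (D-nonneg a j) (eq x (ent D a j))
        where eq : ∀ x d → x - (x - d) ≡ d - 0ℤ
              eq = solve-∀
      drops : ∀ l → leave BD a (suc l) ≤ leave BD a l - ent B a l
      drops l = drop _ (suc l)

    path : Path (+ a , 0ℤ) (0ℤ , + a)
    path = proj₁ built

    open Follows (proj₁ (proj₂ built)) public

    vertical≡ : ∀ l → l ℕ.≤ a → ent D a l ≡ + verticalSteps (+ l) path
    vertical≡ zero    _   = minus-injective (+ a) first
    vertical≡ (suc l) l<a = minus-injective (leave BD a l - ent B a l) (later l z≤n l<a)

    within : ∀ {q} → q ∈ support path →
             Σ[ l ∈ ℕ ] l ℕ.≤ a × proj₂ q ≡ + l × leave BD a l ≤ proj₁ q × proj₁ q ≤ enter BD a l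
    within p = [ (λ r → 0 , z≤n , r) , (λ (l , _ , l<a , r) → suc l , l<a , r) ]′
                 (proj₂ (proj₂ built) p)

  enter<leave : ∀ {a} d l → k ℕ.≤ a → suc (d ℕ.+ a) < n → l ℕ.≤ a →
                enter BD a l ℤ.< leave BD (suc (d ℕ.+ a)) l
  enter<leave {a} zero    l k≤a a< l≤a = ℤ.suc[i]≤j⇒i<j (order a l k≤a a< l≤a)
  enter<leave {a} (suc d) l k≤a a< l≤a = ℤ.<-trans
    (enter<leave d l k≤a (ℕ.<⇒≤ a<) l≤a)
    (ℤ.≤-<-trans (leave≤enter BD D-nonneg (suc (d ℕ.+ a)) l)
      (ℤ.suc[i]≤j⇒i<j (order (suc (d ℕ.+ a)) l (ℕ.≤-trans k≤a a≤) a< (ℕ.≤-trans l≤a a≤))))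
    where
    a≤ : a ℕ.≤ suc (d ℕ.+ a)
    a≤ = ℕ.≤-trans (ℕ.m≤n+m a d) (ℕ.n≤1+n _)

  Between : ℕ → Point → Set
  Between a q = Σ[ l ∈ ℕ ] l ℕ.≤ a × proj₂ q ≡ + l × leave BD a l ≤ proj₁ q × proj₁ q ≤ enter BD a l

  separate : ∀ {a a′ q} → k ℕ.≤ a → a < a′ → a′ < n → Between a q → Between a′ q → ⊥
  separate {a} {a′} k≤a a<a′ a′<n (l , l≤a , c , _ , hi) (l′ , _ , c′ , lo , _)
    with ℤ.+-injective (trans (sym c) c′)
  ... | refl = ℤ.<⇒≱ (subst (λ z → enter BD a l ℤ.< leave BD z l) a′≡
                 (enter<leave (a′ ∸ suc a) l k≤a (subst (_< n) (sym a′≡) a′<n) l≤a))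
               (ℤ.≤-trans lo hi)
    where a′≡ : suc ((a′ ∸ suc a) ℕ.+ a) ≡ a′
          a′≡ = trans (sym (ℕ.+-suc _ a)) (ℕ.m∸n+n≡m a<a′)

  separate-≢ : ∀ {a a′ q} → k ℕ.≤ a → k ℕ.≤ a′ → a < n → a′ < n → a ≢ a′ →
               Between a q → Between a′ q → ⊥
  separate-≢ {a} {a′} k≤a k≤a′ a<n a′<n a≢a′ p p′ with ℕ.<-cmp a a′
  ... | tri< a<a′ _ _ = separate k≤a a<a′ a′<n p p′
  ... | tri≈ _ e _    = a≢a′ e
  ... | tri> _ _ a′<a = separate k≤a′ a′<a a<n p′ p

  isPathfamAt : IsPathfamAt k BD
  isPathfamAt = record
    { isPathfam = record
      { B-entries    = λ i j → subst Bit (ent-! B i j) (bits (toℕ i) (toℕ j))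
      ; B-triangular = λ i j i≤j → trans (sym (ent-! B i j)) (B-lower (toℕ i) (toℕ j) i≤j)
      ; D-entries    = λ i j → subst (0ℤ ≤_) (ent-! D i j) (D-nonneg (toℕ i) (toℕ j))
      ; D-triangular = λ i j i<j → trans (sym (ent-! D i j)) (D-lower (toℕ i) (toℕ j) i<j)
      }
    ; family = path
    ; encodes = record
      { horizontal⇒0 = λ i j j<i p → trans (sym (ent-! B i j)) (hor i (toℕ j) j<i p)
      ; diagonal⇒1   = λ i j j<i p → trans (sym (ent-! B i j)) (diag i (toℕ j) j<i p)
      ; verticals    = λ i j j≤i → trans (sym (ent-! D i j)) (vertical≡ i (toℕ j) j≤i)
      }
    ; noEarlyVertical = λ i j j<k j<i → trans (sym (ent-! D i j)) (early (toℕ i) (toℕ j) j<k j<i)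
    ; disjoint = λ i i′ k≤i k≤i′ i≢i′ (p , p′) →
        separate-≢ k≤i k≤i′ (Fin.toℕ<n i) (Fin.toℕ<n i′) (i≢i′ ∘ Fin.toℕ-injective)
          (within i p) (within i′ p′)
    }

-- The loops

-- The loops cancel from the inside out: the last untangling against the
-- first cliffifying and so on.
forDown-forUp : ∀ {S T : Set} n {up : Fin n → S → S} {dn : Fin n → T → T}
                (P : ℕ → S → Set) (R : ℕ → S → T → Set) {s t} → P 0 s →
                (∀ j s → P (toℕ j) s → P (suc (toℕ j)) (up j s)) →
                (∀ j s t → P (toℕ j) s → R (suc (toℕ j)) (up j s) t → R (toℕ j) s (dn j t)) →
                R n (forUp n up s) t → R 0 s (forDown n dn t)
forDown-forUp zero    P R p step cancel r = r
forDown-forUp {S} {T} (suc n) {up} {dn} P R {s} {t} p step cancel r =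
  forDown-forUp n P R p
    (λ j s → subst (λ a → P a s → P (suc a) (up (inject₁ j) s)) (Fin.toℕ-inject₁ j) (step (inject₁ j) s))
    (λ j s t → subst (λ a → P a s → R (suc a) (up (inject₁ j) s) t → R a s (dn (inject₁ j) t))
                 (Fin.toℕ-inject₁ j) (cancel (inject₁ j) s t))
    (last (forUp n (up ∘ inject₁) s) (forUp-ind n P p λ j s →
      subst (λ a → P a s → P (suc a) (up (inject₁ j) s)) (Fin.toℕ-inject₁ j) (step (inject₁ j) s)) r)
  where
  last : ∀ s → P n s → R (suc n) (up (fromℕ n) s) t → R n s (dn (fromℕ n) t)
  last s = subst (λ a → P a s → R (suc a) (up (fromℕ n) s) t → R a s (dn (fromℕ n) t))
             (Fin.toℕ-fromℕ n) (cancel (fromℕ n) s t)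

forUp-forDown : ∀ {S T : Set} n {up : Fin n → S → S} {dn : Fin n → T → T} (π : T → S)
                (P : ℕ → T → Set) {t} → P n t →
                (∀ j t → P (suc (toℕ j)) t → P (toℕ j) (dn j t) × up j (π (dn j t)) ≡ π t) →
                forUp n up (π (forDown n dn t)) ≡ π t
forUp-forDown zero    π P p cancel = refl
forUp-forDown {S} {T} (suc n) {up} {dn} π P {t} p cancel =
  trans (cong (up (fromℕ n)) (forUp-forDown n π P (proj₁ (last p))
    λ j t → subst
      (λ a → P (suc a) t → P a (dn (inject₁ j) t) × up (inject₁ j) (π (dn (inject₁ j) t)) ≡ π t)
              (Fin.toℕ-inject₁ j) (cancel (inject₁ j) t)))
    (proj₂ (last p))
  where
  last : P (suc n) t → P n (dn (fromℕ n) t) × up (fromℕ n) (π (dn (fromℕ n) t)) ≡ π t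
  last = subst (λ a → P (suc a) t → P a (dn (fromℕ n) t) × up (fromℕ n) (π (dn (fromℕ n) t)) ≡ π t)
           (Fin.toℕ-fromℕ n) (cancel (fromℕ n) t)

sumFirst-suc : (l : ℕ) (v : Vec ℤ n) → sumFirst (suc l) v ≡ sumFirst l v + at v l
sumFirst-suc zero    []       = refl
sumFirst-suc zero    (x ∷ _)  = ℤ.+-comm x 0ℤ
sumFirst-suc (suc l) []       = refl
sumFirst-suc (suc l) (x ∷ v)  =
  trans (cong (λ z → x + z) (sumFirst-suc l v)) (sym (ℤ.+-assoc x (sumFirst l v) (at v l)))

ht-sumFirst : (B : Matrix n) (i : Fin n) (l : ℕ) →
              ht B (toℕ i) l ≡ + toℕ i - sumFirst l (B ! i)
ht-sumFirst B i zero    = sym (ℤ.+-identityʳ (+ toℕ i))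
ht-sumFirst B i (suc l) =
  trans (cong₂ _-_ (ht-sumFirst B i l) (ent-row B i l))
    (trans (eq (+ toℕ i) (sumFirst l (B ! i)) (at (B ! i) l))
      (cong (λ z → + toℕ i - z) (sym (sumFirst-suc l (B ! i)))))
  where eq : ∀ a x y → a - x - y ≡ a - (x + y)
        eq = solve-∀

module Loops {m : ℕ} (k : Fin (suc m)) where
  private
    K : ℕ
    K = toℕ k
    K≤m : K ℕ.≤ m
    K≤m = ℕ.≤-pred (Fin.toℕ<n k)

  -- Stage K ⊔ t of a loop is reached when the counter is at t.
  before : ∀ {t} → t < K → K ℕ.⊔ suc t ≡ K ℕ.⊔ t
  before t<K = trans (ℕ.m≥n⇒m⊔n≡m t<K) (sym (ℕ.m≥n⇒m⊔n≡m (ℕ.<⇒≤ t<K)))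

  after : ∀ {t} → K ℕ.≤ t → K ℕ.⊔ t ≡ t
  after = ℕ.m≤n⇒m⊔n≡n

  up : Fin m → Pair (suc m) → Pair (suc m)
  up i = if does (K ℕ.≤? toℕ i) then untangle i k else id

  down : Fin (suc m) → State (suc m) → State (suc m)
  down i = if does (K ℕ.≤? toℕ i) then cliffifyUnlessLast i k ∘ setHeight k i else id

  up-≤ : ∀ {i s} → K ℕ.≤ toℕ i → up i s ≡ untangle i k s
  up-≤ {i} K≤i rewrite dec-true (K ℕ.≤? toℕ i) K≤i = refl

  up-> : ∀ {i s} → toℕ i < K → up i s ≡ s
  up-> {i} i<K rewrite dec-false (K ℕ.≤? toℕ i) (ℕ.<⇒≱ i<K) = refl

  down-last : ∀ {s} → down (fromℕ m) s ≡ setHeight k (fromℕ m) s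
  down-last rewrite dec-true (K ℕ.≤? toℕ (fromℕ m)) (subst (K ℕ.≤_) (sym (Fin.toℕ-fromℕ m)) K≤m)
                  | view-fromℕ m = refl

  down-≤ : ∀ {i s} → K ℕ.≤ toℕ i → down (inject₁ i) s ≡ cliffify i k (setHeight k (inject₁ i) s)
  down-≤ {i} K≤i rewrite dec-true (K ℕ.≤? toℕ (inject₁ i))
                           (subst (K ℕ.≤_) (sym (Fin.toℕ-inject₁ i)) K≤i)
                       | view-inject₁ i = refl

  down-> : ∀ {i s} → toℕ i < K → down (inject₁ i) s ≡ s
  down-> {i} i<K rewrite dec-false (K ℕ.≤? toℕ (inject₁ i)) 
    (λ K≤i → ℕ.<⇒≱ i<K (subst (K ℕ.≤_) (Fin.toℕ-inject₁ i) K≤i)) = refl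

  Ready : Pair (suc m) → Vec ℤ (suc m) → Set
  Ready BD h = ∀ a → K ℕ.≤ a → a < suc m → 0 < K → at h a ≡ ht (proj₁ BD) a (ℕ.pred K)

  prepared⇒ready : ∀ {BD h} → Prepared k (BD , h) → Ready BD h
  prepared⇒ready {BD} {h} prep a K≤a a<n 0<K with fin a<n
  ... | i , refl = trans (at-! h i) (trans (prep 0<K i K≤a) (sym (ht-sumFirst (proj₁ BD) i (ℕ.pred K))))

  module Comb {BD₀ : Pair (suc m)} (valid : Valid (suc K) BD₀) where
    open Combing k valid

    Inv : ℕ → Pair (suc m) → Set
    Inv t = Stage (K ℕ.⊔ t)

    inv-0 : Inv 0 BD₀
    inv-0 = subst (λ t → Stage t BD₀) (sym (ℕ.⊔-identityʳ K)) first-stage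

    inv-suc : ∀ i s → Inv (toℕ i) s → Inv (suc (toℕ i)) (up i s)
    inv-suc i s inv with K ℕ.≤? toℕ i
    ... | yes K≤i = subst₂ Stage (sym (after (ℕ.m≤n⇒m≤1+n K≤i))) (sym (up-≤ K≤i))
          (next-stage K≤i stage (untangle-spec i k (Stage.bits stage)))
      where stage = subst (λ t → Stage t s) (after K≤i) inv
    ... | no K≰i  = subst₂ Stage (sym (before (ℕ.≰⇒> K≰i))) (sym (up-> (ℕ.≰⇒> K≰i))) inv

    comb-valid : Valid K (combLoop k BD₀)
    comb-valid = last-stage
      (subst (λ t → Stage t (combLoop k BD₀)) (after K≤m) (forUp-ind m Inv inv-0 inv-suc))

    record Undone (t : ℕ) (BD : Pair (suc m)) (s : State (suc m)) : Set where
      field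
        pair   : proj₁ s ≡ BD
        h-done : ∀ a → K ℕ.⊔ t ℕ.≤ a → a < suc m → at (proj₂ s) a ≡ ht (proj₁ BD) a K
        h-todo : ∀ a → K ℕ.≤ a → a < t → 0 < K → at (proj₂ s) a ≡ ht (proj₁ BD) a (ℕ.pred K)

    module _ {h : Vec ℤ (suc m)} (ready : Ready (combLoop k BD₀) h) where

      undone-first : Undone m (combLoop k BD₀) (down (fromℕ m) (combLoop k BD₀ , h))
      undone-first rewrite down-last {combLoop k BD₀ , h} = record
        { pair   = setHeight-pair k (fromℕ m) _
        ; h-done = λ a le a<n → h-done a (ℕ.≤-antisym (ℕ.≤-pred a<n) (ℕ.≤-trans (ℕ.m≤n⊔m K m) le)) a<n
        ; h-todo = λ a K≤a a<m 0<K → trans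
            (setHeight-other k (fromℕ m) _ (λ e → ℕ.<⇒≢ a<m (trans e (Fin.toℕ-fromℕ m))))
            (ready a K≤a (ℕ.m<n⇒m<1+n a<m) 0<K)
        }
        where
        h-done : ∀ a → a ≡ m → a < suc m →
                 at (proj₂ (setHeight k (fromℕ m) (combLoop k BD₀ , h))) a ≡
                 ht (proj₁ (combLoop k BD₀)) a K
        h-done a refl a<n = setHeight-here k (fromℕ m) _ (sym (Fin.toℕ-fromℕ m)) (ready a K≤m a<n)

      undone-cliffify : ∀ {i BD s s₁} → K ℕ.≤ toℕ i → Stage (toℕ i) BD →
        Undone (suc (toℕ i)) (untangle i k BD) s → proj₁ s₁ ≡ untangle i k BD →
        at (proj₂ s₁) (toℕ i) ≡ ht (proj₁ (untangle i k BD)) (toℕ i) K →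
        (∀ a → a ≢ toℕ i → at (proj₂ s₁) a ≡ at (proj₂ s) a) →
        Undone (toℕ i) BD (cliffify i k s₁)
      undone-cliffify {i} {BD} {s} {_ , h₁} K≤i stage u refl h-here h-else = record
        { pair   = proj₂ inverse
        ; h-done = h-done
        ; h-todo = λ a K≤a a<i 0<K →
            let p = ℕ.<⇒≢ a<i
                q = ℕ.<⇒≢ (ℕ.m<n⇒m<1+n a<i) in
            trans (C.h-other p q) (trans (h-else a p) (trans (U.h-todo a K≤a (ℕ.m<n⇒m<1+n a<i) 0<K)
              (shifted-ht-other shifted p q (ℕ.pred K))))
        }
        where
        module U = Undone u
        module S = Stage stage
        ι = toℕ i
        ι<m = s≤s (Fin.toℕ<n i)
        untangled = untangle-spec i k {proj₁ BD} {proj₂ BD} S.bits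
        open Inversion.Untangled-ht i k untangled

        h-next : at h₁ (suc ι) ≡ ht (proj₁ (untangle i k BD)) (suc ι) K
        h-next = trans (h-else (suc ι) (ℕ.>⇒≢ (ℕ.n<1+n ι)))
                   (U.h-done (suc ι) (ℕ.≤-reflexive (after (ℕ.m≤n⇒m≤1+n K≤i))) ι<m)

        cliffified : Cliffified i k (untangle i k BD , h₁) (cliffify i k (untangle i k BD , h₁))
        cliffified = cliffify-spec i k bits (cong₂ (λ x y → x - y - 1ℤ) h-next h-here)
          (ℤ.≤-trans (ℤ.≤-reflexive D-lower) (μ≤gap K ℕ.≤-refl))
        module C = Cliffified cliffified

        D≡0 : ent (proj₂ BD) (suc ι) K ≡ 0ℤ
        D≡0 = trans (S.D-col (suc ι) (ℕ.m≤n⇒m≤1+n K≤i) ι<m)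
          (trans (cong₂ _-_ (S.ht-later K (ℕ.n<1+n ι)) (low-> K (s≤s K≤i)))
                 (ℤ.+-inverseʳ (ht (proj₁ BD₀) (suc ι) K)))

        inverse = Inversion.cliffify∘untangle i k untangled cliffified D≡0

        h-done : ∀ a → K ℕ.⊔ ι ℕ.≤ a → a < suc m →
                 at (proj₂ (cliffify i k (untangle i k BD , h₁))) a ≡ ht (proj₁ BD) a K
        h-done a le a<n with a ℕ.≟ ι | a ℕ.≟ suc ι
        ... | yes refl | _        = trans C.h-upper
              (trans (cong₂ _+_ (trans h-here (ht-upper K ℕ.≤-refl)) D-lower)
                (eq (ht (proj₁ BD) a K) (μ K)))
          where eq : ∀ x y → x - y + y ≡ x
                eq = solve-∀
        ... | no _     | yes refl = trans C.h-lower
              (trans (cong₂ _-_ (trans h-next (ht-lower K ℕ.≤-refl)) D-lower)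
                (eq (ht (proj₁ BD) a K) (μ K)))
          where eq : ∀ x y → x + y - y ≡ x
                eq = solve-∀
        ... | no p     | no q     = trans (C.h-other p q) (trans (h-else a p)
              (trans (U.h-done a (subst (ℕ._≤ a) (sym (after (ℕ.m≤n⇒m≤1+n K≤i)))
                        (ℕ.≤∧≢⇒< (subst (ℕ._≤ a) (after K≤i) le) (p ∘ sym))) a<n)
                (shifted-ht-other shifted p q K)))

      undone-step : ∀ i BD s → Inv (toℕ i) BD → Undone (suc (toℕ i)) (up i BD) s →
                    Undone (toℕ i) BD (down (inject₁ i) s)
      undone-step i BD s inv u with K ℕ.≤? toℕ i
      ... | no K≰i  = subst (Undone (toℕ i) BD) (sym (down-> (ℕ.≰⇒> K≰i))) record
            { pair   = U.pair
            ; h-done = λ a le → U.h-done a (subst (ℕ._≤ a) (sym (before (ℕ.≰⇒> K≰i))) le)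
            ; h-todo = λ a K≤a a<i → ⊥-elim (K≰i (ℕ.≤-trans K≤a (ℕ.<⇒≤ a<i)))
            }
        where module U = Undone (subst (λ BD → Undone (suc (toℕ i)) BD s) (up-> (ℕ.≰⇒> K≰i)) u)
      ... | yes K≤i = subst (Undone (toℕ i) BD) (sym (down-≤ K≤i))
            (undone-cliffify K≤i (subst (λ t → Stage t BD) (after K≤i) inv) u′
              (trans (setHeight-pair k (inject₁ i) s) U.pair)
              (trans (setHeight-here k (inject₁ i) s (sym (Fin.toℕ-inject₁ i)) λ 0<K →
                 trans (U.h-todo (toℕ i) K≤i (ℕ.n<1+n (toℕ i)) 0<K)
                       (cong (λ BD → ht (proj₁ BD) (toℕ i) (ℕ.pred K)) (sym U.pair)))
                 (cong (λ BD → ht (proj₁ BD) (toℕ i) K) U.pair))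
              (λ a a≢i → setHeight-other k (inject₁ i) s λ e → a≢i (trans e (Fin.toℕ-inject₁ i))))
        where
        u′ = subst (λ BD → Undone (suc (toℕ i)) BD s) (up-≤ {i} {BD} K≤i) u
        module U = Undone u′

      uncomb∘comb : proj₁ (uncombLoop k (combLoop k BD₀ , h)) ≡ BD₀
      uncomb∘comb = Undone.pair (forDown-forUp m Inv Undone inv-0 inv-suc undone-step undone-first)

  module Uncomb {BD₀ : Pair (suc m)} (valid : Valid K BD₀)
                {h : Vec ℤ (suc m)} (ready : Ready BD₀ h) where
    open Uncombing k valid

    Inv : ℕ → State (suc m) → Set
    Inv t = Stage (K ℕ.⊔ t)

    inv-m : Inv m (down (fromℕ m) (BD₀ , h))
    inv-m = subst₂ Stage (sym (after K≤m)) (sym down-last)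
      (first-stage (setHeight-pair k (fromℕ m) (BD₀ , h))
        (λ a m≤a a<n → h-done a (ℕ.≤-antisym (ℕ.≤-pred a<n) m≤a) a<n)
        (λ a K≤a a<m 0<K → trans
            (setHeight-other k (fromℕ m) (BD₀ , h) (λ e → ℕ.<⇒≢ a<m (trans e (Fin.toℕ-fromℕ m))))
            (ready a K≤a (ℕ.m<n⇒m<1+n a<m) 0<K)))
      where
      h-done : ∀ a → a ≡ m → a < suc m →
               at (proj₂ (setHeight k (fromℕ m) (BD₀ , h))) a ≡ ht (proj₁ BD₀) a K
      h-done a refl a<n = setHeight-here k (fromℕ m) (BD₀ , h) (sym (Fin.toℕ-fromℕ m)) (ready a K≤m a<n)

    cliffify-stage : ∀ {i s s₁} → K ℕ.≤ toℕ i → Stage (suc (toℕ i)) s → proj₁ s₁ ≡ proj₁ s →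
      at (proj₂ s₁) (toℕ i) ≡ ht (proj₁ (proj₁ s)) (toℕ i) K →
      (∀ a → a ≢ toℕ i → at (proj₂ s₁) a ≡ at (proj₂ s) a) →
      Stage (toℕ i) (cliffify i k s₁) × untangle i k (proj₁ (cliffify i k s₁)) ≡ proj₁ s
    cliffify-stage {i} {s} {_ , h₁} K≤i stage refl h-here h-else =
        next
      , Inversion.untangle∘cliffify i k c (ν₀ K≤i stage h-here h-else c)
          (untangle-spec i k (Stage.bits next))
      where
      c = cliffified K≤i stage h-here h-else
      next = next-stage K≤i stage h-here h-else c

    inv-step : ∀ i s → Inv (suc (toℕ i)) s →
               Inv (toℕ i) (down (inject₁ i) s) × up i (proj₁ (down (inject₁ i) s)) ≡ proj₁ s
    inv-step i s inv with K ℕ.≤? toℕ i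
    ... | no K≰i  =
          subst₂ Stage (before i<K) (sym (down-> {i} {s} i<K)) inv
        , trans (up-> {i} i<K) (cong proj₁ (down-> {i} {s} i<K))
      where i<K = ℕ.≰⇒> K≰i
    ... | yes K≤i =
          subst₂ Stage (sym (after K≤i)) (sym (down-≤ K≤i)) (proj₁ result)
        , trans (up-≤ K≤i) (trans (cong (untangle i k ∘ proj₁) (down-≤ {i} {s} K≤i)) (proj₂ result))
      where
      stage = subst (λ t → Stage t s) (after (ℕ.m≤n⇒m≤1+n K≤i)) inv
      module S = Stage stage
      result = cliffify-stage K≤i stage (setHeight-pair k (inject₁ i) s)
        (setHeight-here k (inject₁ i) s (sym (Fin.toℕ-inject₁ i)) λ 0<K →
           trans (S.h-todo (toℕ i) K≤i (ℕ.n<1+n (toℕ i)) 0<K)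
                 (sym (S.ht-earlier (ℕ.pred K) (ℕ.n<1+n (toℕ i)))))
        (λ a a≢i → setHeight-other k (inject₁ i) s λ e → a≢i (trans e (Fin.toℕ-inject₁ i)))

    uncomb-valid : Valid (suc K) (proj₁ (uncombLoop k (BD₀ , h)))
    uncomb-valid = last-stage (subst (λ t → Stage t (uncombLoop k (BD₀ , h))) (ℕ.⊔-identityʳ K)
      (forDown-ind m Inv inv-m λ i s inv → proj₁ (inv-step i s inv)))

    comb∘uncomb : combLoop k (proj₁ (uncombLoop k (BD₀ , h))) ≡ BD₀
    comb∘uncomb = trans (forUp-forDown m proj₁ Inv inv-m inv-step)
      (trans (cong proj₁ (down-last {BD₀ , h})) (setHeight-pair k (fromℕ m) (BD₀ , h)))

  heights : Pair (suc m) → Vec ℤ (suc m)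
  heights (B , _) = tabulate λ i → + toℕ i - sumFirst (ℕ.pred K) (B ! i)

  heights-ready : ∀ BD → Ready BD (heights BD)
  heights-ready BD = prepared⇒ready {BD} {heights BD} λ _ i _ →
    lookup∘tabulate (λ i → + toℕ i - sumFirst (ℕ.pred K) (proj₁ BD ! i)) i

  combed : Setoid.Carrier (Pathfam (suc m) (suc K)) → Setoid.Carrier (Pathfam (suc m) K)
  combed (BD , elt) = combLoop k BD , ToPaths.isPathfamAt (Comb.comb-valid (FromPaths.valid elt))

  uncombed : Setoid.Carrier (Pathfam (suc m) K) → Setoid.Carrier (Pathfam (suc m) (suc K))
  uncombed (BD , elt) = proj₁ (uncombLoop k (BD , heights BD)) ,
    ToPaths.isPathfamAt (Uncomb.uncomb-valid (FromPaths.valid elt) (heights-ready BD))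

  comb-injective : ∀ {BD BD′} → Valid (suc K) BD → Valid (suc K) BD′ →
                   combLoop k BD ≡ combLoop k BD′ → BD ≡ BD′
  comb-injective {BD} {BD′} v v′ e =
    trans (sym (Comb.uncomb∘comb v (heights-ready (combLoop k BD))))
      (trans (cong (λ BD → proj₁ (uncombLoop k (BD , heights BD))) e)
             (Comb.uncomb∘comb v′ (heights-ready (combLoop k BD′))))

  bijection : Inverse (Pathfam (suc m) (suc K)) (Pathfam (suc m) K)
  bijection = record
    { to        = combed
    ; from      = uncombed
    ; to-cong   = cong (combLoop k)
    ; from-cong = cong λ BD → proj₁ (uncombLoop k (BD , heights BD))
    ; inverse   =
        (λ {(BD , elt)} e → trans (cong (combLoop k) e)
           (Uncomb.comb∘uncomb (FromPaths.valid elt) (heights-ready BD)))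
      , (λ {(BD , elt)} e → trans (cong (λ BD → proj₁ (uncombLoop k (BD , heights BD))) e)
           (Comb.uncomb∘comb (FromPaths.valid elt) (heights-ready (combLoop k BD))))
    }

  -- Any other prepared h gives a preimage under the injective combing as well.
  uncomb-prepared : (y : Setoid.Carrier (Pathfam (suc m) K)) (h : Vec ℤ (suc m)) →
                    Prepared k (proj₁ y , h) →
                    proj₁ (uncombed y) ≡ proj₁ (uncombLoop k (proj₁ y , h))
  uncomb-prepared (BD , elt) h prep = comb-injective
    (U.uncomb-valid (heights-ready BD)) (U.uncomb-valid ready)
    (trans (U.comb∘uncomb (heights-ready BD)) (sym (U.comb∘uncomb ready)))
    where
    module U {h} = Uncomb (FromPaths.valid elt) {h}
    ready = prepared⇒ready {BD} {h} prep

proposition5p2 :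
    (n : ℕ) (k : Fin n) →
    Σ[ φ ∈ Inverse (Pathfam n (suc (toℕ k))) (Pathfam n (toℕ k)) ]
      (((x : Setoid.Carrier (Pathfam n (suc (toℕ k)))) →
          proj₁ (Inverse.to φ x) ≡ combLoop k (proj₁ x))
       ×
       ((y : Setoid.Carrier (Pathfam n (toℕ k))) (h : Vec ℤ n) →
          Prepared k (proj₁ y , h) →
          proj₁ (Inverse.from φ y) ≡ proj₁ (uncombLoop k (proj₁ y , h))))
proposition5p2 (suc m) k = bijection , (λ _ → refl) , uncomb-prepared
  where open Loops k
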